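{- The conflict-free closed neighborhood (CF-CN) coloring problem and the conflict-free open neighborhood (CF-ON) coloring problem can each be solved in polynomial time on cographs: there are polynomial-time algorithms that, given a finite simple connected undirected cograph $G$ and an integer $k$, decide whether $G$ has a CF-CN coloring $V(G)\to\{1,\dots,k\}$ and, respectively, whether $G$ has a CF-ON coloring $V(G)\to\{1,\dots,k\}$.
   Context: A cograph is a graph with no induced path on four vertices ($P_4$-free graph). Let $N(v)$ be the set of vertices adjacent to $v$ and $N[v]=N(v)\cup\{v\}$. For a coloring $C_G:V(G)\to\{1,\dots,k\}$ (not necessarily proper), a set $U\subseteq V(G)$ has a unique color if there is a color $c$ with $|\{u\in U: C_G(u)=c\}|=1$. The coloring is a conflict-free closed neighborhood (CF-CN) coloring if $N[v]$ has a unique color for every $v\in V(G)$, and a conflict-free open neighborhood (CF-ON) coloring if $N(v)$ has a unique color for every $v\in V(G)$. -}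

module Defs where

open import Data.Bool.Base using (Bool; false; true; T; if_then_else_)
open import Data.Digit using (Bit; 0b; 1b; toDigits)
open import Data.Fin.Base using (Fin; toℕ)
import Data.Fin.Properties as Fin
open import Data.Fin.Subset using (Subset; ∣_∣; _∩_; _∪_; ⁅_⁆)
open import Data.List.Base
  using (List; []; _∷_; _++_; concat; length; replicate; tabulate)
open import Data.Nat.Base
  using (ℕ; zero; suc; _+_; _*_; _∸_; _^_; _≤_; _≡ᵇ_; ∣_-_∣; NonZero)
open import Data.Nat.Properties using (∣-∣-comm; ∣n-n∣≡0)
open import Data.Product.Base using (∃; ∃-syntax; _×_; proj₁)
import Data.Vec.Base as Vec
open import Function.Bundles using (_⇔_)
open import Function.Definitions using (Injective)
open import Relation.Binary.Construct.Closure.ReflexiveTransitive using (Star)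
open import Relation.Binary.PropositionalEquality using (_≡_; _≢_; cong)
open import Relation.Nullary using (¬_; does)

------------------------------------------------------------------------
-- Finite simple graphs

record Graph (n : ℕ) : Set where
  field
    adj        : Fin n → Fin n → Bool
    adj-sym    : ∀ u v → adj u v ≡ adj v u
    adj-irrefl : ∀ v → adj v v ≡ false

open Graph public

Adjacent : ∀ {n} → Graph n → Fin n → Fin n → Set
Adjacent G u v = T (adj G u v)

-- The graph without vertices does not count as connected.

Connected : ∀ {n} → Graph n → Set
Connected {n} G = NonZero n × (∀ u v → Star (Adjacent G) u v)

InducedSubgraph : ∀ {m n} → Graph m → Graph n → Set
InducedSubgraph {m} {n} H G =
  ∃[ f ] Injective {A = Fin m} {B = Fin n} _≡_ _≡_ f
       × (∀ i j → adj G (f i) (f j) ≡ adj H i j)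

P₄ : Graph 4
P₄ = record
  { adj        = λ i j → ∣ toℕ i - toℕ j ∣ ≡ᵇ 1
  ; adj-sym    = λ i j → cong (_≡ᵇ 1) (∣-∣-comm (toℕ i) (toℕ j))
  ; adj-irrefl = λ i → cong (_≡ᵇ 1) (∣n-n∣≡0 (toℕ i))
  }

Cograph : ∀ {n} → Graph n → Set
Cograph G = ¬ InducedSubgraph P₄ G

------------------------------------------------------------------------
-- Conflict-free colourings

N⟨_⟩ : ∀ {n} → Graph n → Fin n → Subset n
N⟨ G ⟩ v = Vec.tabulate (adj G v)

N[_] : ∀ {n} → Graph n → Fin n → Subset n
N[ G ] v = N⟨ G ⟩ v ∪ ⁅ v ⁆

Colouring : ℕ → ℕ → Set
Colouring n k = Fin n → Fin k

colourClass : ∀ {n k} → Colouring n k → Fin k → Subset n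
colourClass C c = Vec.tabulate (λ u → does (C u Fin.≟ c))

HasUniqueColour : ∀ {n k} → Colouring n k → Subset n → Set
HasUniqueColour C U = ∃[ c ] ∣ U ∩ colourClass C c ∣ ≡ 1

IsCFCN : ∀ {n k} → Graph n → Colouring n k → Set
IsCFCN G C = ∀ v → HasUniqueColour C (N[ G ] v)

IsCFON : ∀ {n k} → Graph n → Colouring n k → Set
IsCFON G C = ∀ v → HasUniqueColour C (N⟨ G ⟩ v)

------------------------------------------------------------------------
-- Random access machines, programmed by while-programs

-- A state consists of registers, which a program addresses by
-- constants only, and a memory, which it can address by computed values.

record State : Set where
  constructor ⟪_,_⟫
  field
    regs : ℕ → ℕ
    mem  : ℕ → ℕ

open State public

infixl 6 _⊕_ _⊖_

data Expr : Set where
  lit     : ℕ → Expr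
  reg     : ℕ → Expr
  load    : Expr → Expr
  _⊕_ _⊖_ : Expr → Expr → Expr

⟦_⟧ : Expr → State → ℕ
⟦ lit m   ⟧ σ = m
⟦ reg x   ⟧ σ = regs σ x
⟦ load e  ⟧ σ = mem σ (⟦ e ⟧ σ)
⟦ e₁ ⊕ e₂ ⟧ σ = ⟦ e₁ ⟧ σ + ⟦ e₂ ⟧ σ
⟦ e₁ ⊖ e₂ ⟧ σ = ⟦ e₁ ⟧ σ ∸ ⟦ e₂ ⟧ σ

-- Every operation has unit cost.  There is no multiplication, so after
-- t steps all numbers have O(t + log (size of the input)) bits, and
-- polynomial time agrees with polynomial time on Turing machines.

cost : Expr → ℕ
cost (lit m)   = 1
cost (reg x)   = 1
cost (load e)  = 1 + cost e
cost (e₁ ⊕ e₂) = 1 + cost e₁ + cost e₂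
cost (e₁ ⊖ e₂) = 1 + cost e₁ + cost e₂

infix  5 _≔_ mem[_]≔_
infixr 4 _⨾_

data Program : Set where
  skip     : Program
  _≔_      : ℕ → Expr → Program
  mem[_]≔_ : Expr → Expr → Program
  _⨾_      : Program → Program → Program
  ifnz     : Expr → Program → Program → Program
  whilenz  : Expr → Program → Program

_[_↦_] : (ℕ → ℕ) → ℕ → ℕ → (ℕ → ℕ)
(f [ x ↦ m ]) y = if x ≡ᵇ y then m else f y

-- p ∶ σ ⇓[ t ] σ′ : started in σ, the program p halts in σ′ after time t.

infix 3 _∶_⇓[_]_

data _∶_⇓[_]_ : Program → State → ℕ → State → Set where
  ⇓skip : ∀ {σ} → skip ∶ σ ⇓[ 1 ] σ
  ⇓reg : ∀ {x e σ} →
    (x ≔ e) ∶ σ ⇓[ 1 + cost e ] ⟪ regs σ [ x ↦ ⟦ e ⟧ σ ] , mem σ ⟫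
  ⇓mem : ∀ {a e σ} →
    (mem[ a ]≔ e) ∶ σ ⇓[ 1 + cost a + cost e ]
      ⟪ regs σ , mem σ [ ⟦ a ⟧ σ ↦ ⟦ e ⟧ σ ] ⟫
  ⇓seq : ∀ {p q σ σ′ σ″ s t} →
    p ∶ σ ⇓[ s ] σ′ → q ∶ σ′ ⇓[ t ] σ″ → (p ⨾ q) ∶ σ ⇓[ s + t ] σ″
  ⇓ifnz-then : ∀ {e p q σ σ′ t} → ⟦ e ⟧ σ ≢ 0 →
    p ∶ σ ⇓[ t ] σ′ → ifnz e p q ∶ σ ⇓[ 1 + cost e + t ] σ′
  ⇓ifnz-else : ∀ {e p q σ σ′ t} → ⟦ e ⟧ σ ≡ 0 →
    q ∶ σ ⇓[ t ] σ′ → ifnz e p q ∶ σ ⇓[ 1 + cost e + t ] σ′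
  ⇓while-stop : ∀ {e p σ} → ⟦ e ⟧ σ ≡ 0 →
    whilenz e p ∶ σ ⇓[ 1 + cost e ] σ
  ⇓while-step : ∀ {e p σ σ′ σ″ s t} → ⟦ e ⟧ σ ≢ 0 →
    p ∶ σ ⇓[ s ] σ′ → whilenz e p ∶ σ′ ⇓[ t ] σ″ →
    whilenz e p ∶ σ ⇓[ 1 + cost e + s + t ] σ″

-- The input is a bit string, stored from memory address 0 onwards; its
-- length is in register 0, and everything else is 0.

cells : List Bit → ℕ → ℕ
cells []       _       = 0
cells (b ∷ bs) zero    = toℕ b
cells (b ∷ bs) (suc i) = cells bs i

initial : List Bit → State
initial bs = ⟪ (λ _ → 0) [ 0 ↦ length bs ] , cells bs ⟫

Accepting : State → Set
Accepting σ = regs σ 0 ≡ 1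

-- One program, with one polynomial time bound, halts on all instances
-- satisfying the promise and accepts exactly the yes-instances among them.

PolyTimeDecidable : {A : Set} → (A → List Bit) →
                    (Promise Yes : A → Set) → Set
PolyTimeDecidable {A} encode Promise Yes =
  ∃[ p ] ∃[ c ] ∃[ d ] ((x : A) → Promise x →
    ∃[ t ] ∃[ σ ] (p ∶ initial (encode x) ⇓[ t ] σ)
                × t ≤ c * (1 + length (encode x)) ^ d
                × (Accepting σ ⇔ Yes x))

------------------------------------------------------------------------
-- The two colouring problems

record Instance : Set where
  field
    order   : ℕ
    graph   : Graph order
    colours : ℕ

open Instance public

bit : Bool → Bit
bit b = if b then 1b else 0b

-- The order in unary, a separator, the adjacency matrix row by row, and
-- finally the number of colours in binary, least significant bit first.

encode : Instance → List Bit
encode I =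
  replicate (order I) 1b ++ 0b ∷
  concat (tabulate λ u → tabulate λ v → bit (adj (graph I) u v)) ++
  proj₁ (toDigits 2 (colours I))

ConnectedCograph : Instance → Set
ConnectedCograph I = Connected (graph I) × Cograph (graph I)

CFCNColourable : Instance → Set
CFCNColourable I = ∃ λ (C : Colouring (order I) (colours I)) → IsCFCN (graph I) C

CFONColourable : Instance → Set
CFONColourable I = ∃ λ (C : Colouring (order I) (colours I)) → IsCFON (graph I) C

{-# OPTIONS --safe #-}

-- A connected cograph with at least two vertices is the join of two parts.
-- Colouring one vertex of each part with a colour of its own and all other
-- vertices with a third colour is conflict-free, so three colours suffice
-- and only two colours are of interest.  In a 2-colouring every vertex
-- sees a red or a blue vertex exactly once.  If vertices of both parts see
-- the same colour once, then each part has at most one vertex of that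
-- colour, as every vertex sees the whole other part.  Otherwise one part A
-- sees red once and the other part B sees blue once.  If B has no red
-- vertex, then red is N(b) minus one vertex, for any b in B; if A has no
-- blue vertex, then likewise for blue; and otherwise two vertices can be
-- chosen as the red class.  Hence only the O(n²) colour classes {u , v}
-- and N(u) ∖ {v} have to be tried.
--
-- This search is a first-order formula with quantifiers bounded by n.  It
-- is written as an arithmetical term with bounded sums, and all such terms
-- can be evaluated by while-programs in polynomial time.

module Submission where

open import Defs
open import Data.Bool.Base using (Bool; true; false; not; T; if_then_else_)
open import Data.Bool.Properties using (not-¬) renaming (_≟_ to _≟ᵇ_)
open import Data.Digit using (Bit; 0b; 1b; fromDigits; toDigits)
open import Data.Empty using (⊥; ⊥-elim)
open import Data.Fin.Base using (Fin; zero; suc; toℕ; fromℕ<)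
open import Data.Fin.Patterns
open import Data.Fin.Properties
  using (_≟_; any?; all?; toℕ<n; toℕ-fromℕ<; toℕ-injective)
open import Data.Fin.Subset using (Subset; ∣_∣; _∩_; _∪_; ⁅_⁆; _∈_)
open import Data.Fin.Subset.Properties
  using (nonempty?; Empty-unique; ∣⊥∣≡0; p⊂q⇒∣p∣<∣q∣; x∈⁅y⁆⇒x≡y; x≢y⇒x∉⁅y⁆; ∣⁅x⁆∣≡1
        ; ⊆-antisym; x∈⁅x⁆; x∈p∪q⁻; x∈p∪q⁺; x∈p∩q⁻; x∈p∩q⁺)
open import Data.List.Base
  using (List; []; _∷_; _++_; concat; drop; length; replicate; tabulate)
open import Data.List.Properties
  using (length-++; length-tabulate; ++-assoc; length-replicate; length-drop)
open import Data.Nat.Base hiding (∣_-_∣)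
open import Data.Nat.Properties hiding (_≟_)
open import Data.Product.Base as Product using (∃; ∃-syntax; _×_; _,_; proj₁; proj₂)
open import Data.Sum.Base as Sum using (_⊎_; inj₁; inj₂)
import Data.Vec.Base as Vec
open import Data.Vec.Functional using () renaming (_∷_ to infixr 5 _∷ˢ_)
open import Data.Vec.Properties using (lookup∘tabulate; []=⇒lookup; lookup⇒[]=)
open import Function.Base using (_∘_; case_of_; id)
open import Function.Bundles using (_⇔_; mk⇔; Equivalence)
open import Function.Construct.Symmetry using (⇔-sym)
open import Relation.Binary.Construct.Closure.ReflexiveTransitive using (Star; ε; _◅_)
open import Relation.Binary.PropositionalEquality
open import Relation.Nullary using (¬_; Dec; yes; no; contradiction; does)
open import Relation.Nullary.Decidable
  using (_×-dec_; _⊎-dec_; _→-dec_; ¬?; from-yes; dec-true; dec-false)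
open import Relation.Unary using (Decidable)

open Equivalence

-- While-programs for terms with bounded sums

infixl 6 _⊞_ _⊟_
infix  5 ∑[_<_]_

data Term : Set where
  con      : ℕ → Term
  var      : ℕ → Term
  cell     : Term → Term
  _⊞_ _⊟_  : Term → Term → Term
  ∑[_<_]_  : ℕ → Term → Term → Term

-- The top index comes first because the compiled loop counts its register down to zero.
∑ : ℕ → (ℕ → ℕ) → ℕ
∑ zero    f = 0
∑ (suc n) f = f n + ∑ n f

eval : Term → (ℕ → ℕ) → (ℕ → ℕ) → ℕ
eval (con m)        η μ = m
eval (var x)        η μ = η x
eval (cell t)       η μ = μ (eval t η μ)
eval (a ⊞ b)        η μ = eval a η μ + eval b η μ
eval (a ⊟ b)        η μ = eval a η μ ∸ eval b η μ
eval (∑[ x < a ] b) η μ = ∑ (eval a η μ) (λ i → eval b (η [ x ↦ i ]) μ)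

-- The value of the term is left in register s; the registers from s
-- onwards are scratch space, and ρ assigns registers to the variables.

compile : Term → (ℕ → ℕ) → ℕ → Program
compile (con m)        ρ s = s ≔ lit m
compile (var x)        ρ s = s ≔ reg (ρ x)
compile (cell t)       ρ s = compile t ρ s ⨾ s ≔ load (reg s)
compile (a ⊞ b)        ρ s =
  compile a ρ s ⨾ compile b ρ (1 + s) ⨾ s ≔ reg s ⊕ reg (1 + s)
compile (a ⊟ b)        ρ s =
  compile a ρ s ⨾ compile b ρ (1 + s) ⨾ s ≔ reg s ⊖ reg (1 + s)
compile (∑[ x < a ] b) ρ s =
  compile a ρ (1 + s) ⨾ s ≔ lit 0 ⨾ whilenz (reg (1 + s))
    ( 1 + s ≔ reg (1 + s) ⊖ lit 1
    ⨾ compile b (ρ [ x ↦ 1 + s ]) (2 + s)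
    ⨾ s ≔ reg s ⊕ reg (2 + s))

-- Exact costs: 2 for each loop test, 4 for decrementing the counter and 4 for adding to the
-- accumulator.
loopTime : ℕ → (ℕ → ℕ) → ℕ
loopTime zero    f = 2
loopTime (suc n) f = 2 + (4 + (f n + 4)) + loopTime n f

time : Term → (ℕ → ℕ) → (ℕ → ℕ) → ℕ
time (con m)        η μ = 2
time (var x)        η μ = 2
time (cell t)       η μ = time t η μ + 3
time (a ⊞ b)        η μ = time a η μ + (time b η μ + 4)
time (a ⊟ b)        η μ = time a η μ + (time b η μ + 4)
time (∑[ x < a ] b) η μ = time a η μ +
  (2 + loopTime (eval a η μ) (λ i → time b (η [ x ↦ i ]) μ))

-- Correctness and exact running time of compiled terms

↦-same : ∀ (f : ℕ → ℕ) x m → (f [ x ↦ m ]) x ≡ m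
↦-same f x m with x ≡ᵇ x in eq
... | true  = refl
... | false = ⊥-elim (subst T eq (≡⇒≡ᵇ x x refl))

↦-other : ∀ (f : ℕ → ℕ) {x y} m → y ≢ x → (f [ x ↦ m ]) y ≡ f y
↦-other f {x} {y} m y≢x with x ≡ᵇ y in eq
... | false = refl
... | true  = ⊥-elim (y≢x (sym (≡ᵇ⇒≡ x y (subst T (sym eq) _))))

record Represents (ρ : ℕ → ℕ) (s : ℕ) (η μ : ℕ → ℕ) (σ : State) : Set where
  field
    bounded : ∀ x → ρ x < s
    agree   : ∀ x → regs σ (ρ x) ≡ η x
    memory  : mem σ ≡ μ

open Represents

-- `below` is the frame condition: registers under `s` survive, so variables and earlier
-- intermediate results stay readable. Compiled terms only read the memory, hence the plain equality
-- in `unchanged`.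
record Computes (p : Program) (t s v : ℕ) (μ : ℕ → ℕ) (σ : State) : Set where
  field
    final     : State
    run       : p ∶ σ ⇓[ t ] final
    result    : regs final s ≡ v
    below     : ∀ {y} → y < s → regs final y ≡ regs σ y
    unchanged : mem final ≡ μ

open Computes

assign : ∀ {s e v μ σ} → ⟦ e ⟧ σ ≡ v → mem σ ≡ μ →
         Computes (s ≔ e) (1 + cost e) s v μ σ
assign {s} {e} {v} {μ} {σ} e≡v m = record
  { final     = _
  ; run       = ⇓reg
  ; result    = trans (↦-same (regs σ) s _) e≡v
  ; below     = λ y<s → ↦-other (regs σ) _ (<⇒≢ y<s)
  ; unchanged = m
  }

then : ∀ {p q t₁ t₂ s₁ s₂ v₁ v₂ μ σ} → s₂ ≤ s₁ →
       (c : Computes p t₁ s₁ v₁ μ σ) → Computes q t₂ s₂ v₂ μ (final c) →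
       Computes (p ⨾ q) (t₁ + t₂) s₂ v₂ μ σ
then s₂≤s₁ c d = record
  { final     = final d
  ; run       = ⇓seq (run c) (run d)
  ; result    = result d
  ; below     = λ y<s → trans (below d y<s) (below c (<-≤-trans y<s s₂≤s₁))
  ; unchanged = unchanged d
  }

lift : ∀ {ρ s s′ η μ σ} → s ≤ s′ → Represents ρ s η μ σ → Represents ρ s′ η μ σ
lift s≤s′ r = record
  { bounded = λ x → <-≤-trans (bounded r x) s≤s′
  ; agree   = agree r
  ; memory  = memory r
  }

after : ∀ {ρ s s′ η μ σ p t v} → s ≤ s′ → Represents ρ s η μ σ →
        (c : Computes p t s′ v μ σ) → Represents ρ s η μ (final c)
after s≤s′ r c = record
  { bounded = bounded r
  ; agree   = λ x → trans (below c (<-≤-trans (bounded r x) s≤s′)) (agree r x)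
  ; memory  = unchanged c
  }

-- The loop counter itself serves as the register of the bound variable, so the scratch space of the
-- body starts just above it.
bind : ∀ {ρ s s′ η μ σ i} x → s ≤ s′ → Represents ρ s η μ σ → regs σ s′ ≡ i →
       Represents (ρ [ x ↦ s′ ]) (1 + s′) (η [ x ↦ i ]) μ σ
bind {ρ} {s} {s′} {η} {μ} {σ} {i} x s≤s′ r e = record
  { bounded = bounded′
  ; agree   = agree′
  ; memory  = memory r
  }
  where
  bounded′ : ∀ y → (ρ [ x ↦ s′ ]) y < 1 + s′
  bounded′ y with x ≡ᵇ y
  ... | true  = ≤-refl
  ... | false = m<n⇒m<1+n (<-≤-trans (bounded r y) s≤s′)
  agree′ : ∀ y → regs σ ((ρ [ x ↦ s′ ]) y) ≡ (η [ x ↦ i ]) y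
  agree′ y with x ≡ᵇ y
  ... | true  = e
  ... | false = agree r y

mutual

  compile-correct : ∀ t {ρ s η μ σ} → Represents ρ s η μ σ →
    Computes (compile t ρ s) (time t η μ) s (eval t η μ) μ σ
  compile-correct (con m) r = assign refl (memory r)
  compile-correct (var x) r = assign (agree r x) (memory r)
  compile-correct (cell t) {s = s} {μ = μ} r =
    then ≤-refl c (assign (cong₂ (λ m a → m a) (unchanged c) (result c)) (unchanged c))
    where c = compile-correct t r
  compile-correct (a ⊞ b) {s = s} r =
    then ≤-refl c (then (n≤1+n s) d (assign
      (cong₂ _+_ (trans (below d ≤-refl) (result c)) (result d)) (unchanged d)))
    where
    c = compile-correct a r
    d = compile-correct b (lift (n≤1+n s) (after ≤-refl r c))
  compile-correct (a ⊟ b) {s = s} r =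
    then ≤-refl c (then (n≤1+n s) d (assign
      (cong₂ _∸_ (trans (below d ≤-refl) (result c)) (result d)) (unchanged d)))
    where
    c = compile-correct a r
    d = compile-correct b (lift (n≤1+n s) (after ≤-refl r c))
  compile-correct (∑[ x < a ] b) {s = s} {μ = μ} r =
    then (n≤1+n s) c (then ≤-refl d (loop-correct x b _ (after ≤-refl (after (n≤1+n s) r c) d)
      (trans (↦-other (regs (final c)) {s} 0 1+n≢n) (result c)) (result d)))
    where
    c = compile-correct a (lift (n≤1+n s) r)
    d : Computes (s ≔ lit 0) 2 s 0 μ (final c)
    d = assign refl (unchanged c)

  -- Induction on the counter, with an arbitrary accumulator `acc` because each iteration changes
  -- it. The counter is decremented before the body runs, so the body sees the indices from `n - 1`
  -- down to 0.
  loop-correct : ∀ x b n {ρ s η μ σ acc} → Represents ρ s η μ σ →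
    regs σ (1 + s) ≡ n → regs σ s ≡ acc →
    Computes
      (whilenz (reg (1 + s))
        ( 1 + s ≔ reg (1 + s) ⊖ lit 1
        ⨾ compile b (ρ [ x ↦ 1 + s ]) (2 + s)
        ⨾ s ≔ reg s ⊕ reg (2 + s)))
      (loopTime n (λ i → time b (η [ x ↦ i ]) μ)) s
      (acc + ∑ n (λ i → eval b (η [ x ↦ i ]) μ)) μ σ
  loop-correct x b zero {σ = σ} r counter acc = record
    { final     = σ
    ; run       = ⇓while-stop counter
    ; result    = trans acc (sym (+-identityʳ _))
    ; below     = λ _ → refl
    ; unchanged = memory r
    }
  loop-correct x b (suc n) {ρ} {s} {η} {μ} {σ} {acc} r counter accumulated = record
    { final     = final rest
    ; run       = ⇓while-step (λ e → 1+n≢0 (trans (sym counter) e)) (run step) (run rest)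
    ; result    = trans (result rest) (+-assoc acc _ _)
    ; below     = λ y<s → trans (below rest y<s) (below step y<s)
    ; unchanged = unchanged rest
    }
    where
    c : Computes (1 + s ≔ reg (1 + s) ⊖ lit 1) 4 (1 + s) n μ σ
    c = assign (cong (_∸ 1) counter) (memory r)
    d = compile-correct b (bind x (n≤1+n s) (after (n≤1+n s) r c) (result c))
    keeps : ∀ {y} → y ≤ s → regs (final d) y ≡ regs σ y
    keeps y≤s = trans (below d (s≤s (m≤n⇒m≤1+n y≤s))) (below c (s≤s y≤s))
    e : Computes (s ≔ reg s ⊕ reg (2 + s)) 4 s
          (acc + eval b (η [ x ↦ n ]) μ) μ (final d)
    e = assign (cong₂ _+_ (trans (keeps ≤-refl) accumulated) (result d)) (unchanged d)
    step = then (n≤1+n s) c (then (m≤n+m s 2) d e)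
    rest = loop-correct x b n (after ≤-refl r step)
      (trans (↦-other (regs (final d)) {s} _ 1+n≢n)
        (trans (below d ≤-refl) (result c)))
      (result step)

-- Polynomial bounds

∑-bound : ∀ n {f B} → (∀ {i} → i < n → f i ≤ B) → ∑ n f ≤ n * B
∑-bound zero    f≤B = z≤n
∑-bound (suc n) f≤B = +-mono-≤ (f≤B ≤-refl) (∑-bound n (λ i<n → f≤B (m<n⇒m<1+n i<n)))

loopTime-bound : ∀ n {f B} → (∀ {i} → i < n → f i ≤ B) → loopTime n f ≤ n * (2 + (4 + (B + 4))) + 2
loopTime-bound zero    f≤B = ≤-refl
loopTime-bound (suc n) {f} {B} f≤B = ≤-trans
  (+-mono-≤ (+-monoʳ-≤ 2 (+-monoʳ-≤ 4 (+-monoˡ-≤ 4 (f≤B ≤-refl))))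
            (loopTime-bound n (λ i<n → f≤B (m<n⇒m<1+n i<n))))
  (≤-reflexive (sym (+-assoc (2 + (4 + (B + 4))) _ 2)))

-- All bounds are powers of one base, later one plus the length of the input. Products add
-- exponents, and since `M` is at least 2 a sum costs one exponent more, so that estimates become
-- arithmetic on exponents alone.
module Powers (M : ℕ) (2≤M : 2 ≤ M) where

  instance
    M≢0 : NonZero M
    M≢0 = >-nonZero (<-≤-trans z<s 2≤M)

  small-con : ∀ m → m ≤ M ^ m
  small-con zero    = z≤n
  small-con (suc m) = begin
    1 + m         ≤⟨ +-mono-≤ (m^n>0 M m) (small-con m) ⟩
    M ^ m + M ^ m ≡⟨ cong (M ^ m +_) (+-identityʳ (M ^ m)) ⟨
    2 * M ^ m     ≤⟨ *-monoˡ-≤ (M ^ m) 2≤M ⟩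
    M * M ^ m     ∎
    where open ≤-Reasoning

  small-* : ∀ {a b} x y → a ≤ M ^ x → b ≤ M ^ y → a * b ≤ M ^ (x + y)
  small-* x y p q = ≤-trans (*-mono-≤ p q) (≤-reflexive (sym (^-distribˡ-+-* M x y)))

  small-+ : ∀ {a b} x y → a ≤ M ^ x → b ≤ M ^ y → a + b ≤ M ^ (1 + x + y)
  small-+ {a} {b} x y p q = begin
    a + b                     ≤⟨ +-mono-≤ p q ⟩
    M ^ x + M ^ y             ≤⟨ +-mono-≤ (^-monoʳ-≤ M (m≤m+n x y)) (^-monoʳ-≤ M (m≤n+m y x)) ⟩
    M ^ (x + y) + M ^ (x + y) ≡⟨ cong (M ^ (x + y) +_) (+-identityʳ _) ⟨
    2 * M ^ (x + y)           ≤⟨ *-monoˡ-≤ (M ^ (x + y)) 2≤M ⟩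
    M * M ^ (x + y)           ∎
    where open ≤-Reasoning

Bounded : (ℕ → ℕ) → ℕ → Set
Bounded f b = ∀ x → f x ≤ b

bounded-↦ : ∀ {f b i} x → Bounded f b → i ≤ b → Bounded (f [ x ↦ i ]) b
bounded-↦ x f≤b i≤b y with x ≡ᵇ y
... | true  = i≤b
... | false = f≤b y

-- The exponents are found by recursion on the term, before `M` and the environment are given; this
-- makes the bound uniform over all inputs.
polynomially-bounded : ∀ t g → ∃[ d ] ∃[ e ] (∀ {M η μ} → 2 ≤ M →
  Bounded η (M ^ g) → Bounded μ (M ^ g) →
  eval t η μ ≤ M ^ d × time t η μ ≤ M ^ e)
polynomially-bounded (con m) g = m , 2 , λ {M} 2≤M p q →
  let open Powers M 2≤M in small-con m , small-con 2
polynomially-bounded (var x) g = g , 2 , λ {M} 2≤M p q →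
  let open Powers M 2≤M in p x , small-con 2
polynomially-bounded (cell t) g with polynomially-bounded t g
... | d , e , b = g , 1 + e + 3 , λ {M} 2≤M p q →
  let open Powers M 2≤M in
  q _ , small-+ e 3 (proj₂ (b 2≤M p q)) (small-con 3)
polynomially-bounded (s ⊞ t) g with polynomially-bounded s g | polynomially-bounded t g
... | d , e , b | d′ , e′ , b′ = 1 + d + d′ , 1 + e + (1 + e′ + 4) , λ {M} 2≤M p q →
  let open Powers M 2≤M
      v , w   = b 2≤M p q
      v′ , w′ = b′ 2≤M p q
  in small-+ d d′ v v′ , small-+ e _ w (small-+ e′ 4 w′ (small-con 4))
polynomially-bounded (s ⊟ t) g with polynomially-bounded s g | polynomially-bounded t g
... | d , e , b | d′ , e′ , b′ = d , 1 + e + (1 + e′ + 4) , λ {M} {η} {μ} 2≤M p q →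
  let open Powers M 2≤M
      v , w   = b 2≤M p q
      v′ , w′ = b′ 2≤M p q
  in ≤-trans (m∸n≤m (eval s η μ) (eval t η μ)) v , small-+ e _ w (small-+ e′ 4 w′ (small-con 4))
polynomially-bounded (∑[ x < s ] t) g with polynomially-bounded s g
-- The bound variable stays below `M ^ d` and everything else below `M ^ g`, so `M ^ (g + d)` covers
-- the environment of the body.
... | d , e , b with polynomially-bounded t (g + d)
... | d′ , e′ , b′ =
  -- `e₁` is the exponent for one iteration and `e₂` the one for the whole loop, following the shape
  -- of `loopTime-bound`.
  let e₁ = 1 + 2 + (1 + 4 + (1 + e′ + 4))
      e₂ = 1 + (d + e₁) + 2
  in d + d′ , 1 + e + (1 + 2 + e₂) , λ {M} {η} {μ} 2≤M p q →
  let open Powers M 2≤M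
      v , w = b 2≤M p q
      body : ∀ {i} → i < eval s η μ →
             eval t (η [ x ↦ i ]) μ ≤ M ^ d′ × time t (η [ x ↦ i ]) μ ≤ M ^ e′
      body i<n = b′ 2≤M
                   (bounded-↦ x (λ y → ≤-trans (p y) (^-monoʳ-≤ M (m≤m+n g d)))
                     (≤-trans (<⇒≤ i<n) (≤-trans v (^-monoʳ-≤ M (m≤n+m d g)))))
                   (λ a → ≤-trans (q a) (^-monoʳ-≤ M (m≤m+n g d)))
  in ≤-trans (∑-bound _ (λ i<n → proj₁ (body i<n))) (small-* d d′ v ≤-refl)
   , small-+ e (1 + 2 + e₂) w (small-+ 2 e₂ (small-con 2)
       (≤-trans (loopTime-bound (eval s η μ) (λ i<n → proj₂ (body i<n)))
         (small-+ (d + e₁) 2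
           (small-* d e₁ v
             (small-+ 2 (1 + 4 + (1 + e′ + 4)) (small-con 2)
               (small-+ 4 (1 + e′ + 4) (small-con 4) (small-+ e′ 4 ≤-refl (small-con 4)))))
           (small-con 2))))

cells≤1 : ∀ bs → Bounded (cells bs) 1
cells≤1 []       _       = z≤n
cells≤1 (b ∷ bs) zero    = s≤s⁻¹ (toℕ<n b)
cells≤1 (b ∷ bs) (suc i) = cells≤1 bs i

-- Variables that no sum binds denote the length of the input.

free : List Bit → ℕ → ℕ
free bs _ = length bs

-- Register 0 holds the input length and stands for all free variables, so the value is computed in
-- register 1. Two truncated subtractions from 1, taking time 6, then turn every nonzero value into
-- exactly 1. A nonempty input makes the base of the powers at least 2.
decided-by : ∀ {A : Set} (code : A → List Bit) {Promise Yes : A → Set} (t : Term) →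
  (∀ x → Promise x → 0 < length (code x)) →
  (∀ x → Promise x → eval t (free (code x)) (cells (code x)) ≢ 0 ⇔ Yes x) →
  PolyTimeDecidable code Promise Yes
decided-by code t nonempty correct with polynomially-bounded t 1
... | d , e , small = (compile t (λ _ → 0) 1 ⨾ 0 ≔ normalised) , 1 , 1 + e + 6 , λ x promise →
  let open Powers (1 + length (code x)) (s≤s (nonempty x promise))
      c : Computes (compile t (λ _ → 0) 1) (time t (free (code x)) (cells (code x))) 1
            (eval t (free (code x)) (cells (code x))) (cells (code x)) (initial (code x))
      c = compile-correct t record { bounded = λ _ → s≤s z≤n ; agree = λ _ → refl ; memory = refl }
      v≡ : 1 ∸ (1 ∸ regs (final c) 1) ≡ 1 ∸ (1 ∸ eval t (free (code x)) (cells (code x)))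
      v≡ = cong (λ v → 1 ∸ (1 ∸ v)) (result c)
  in _ , _ , ⇓seq (run c) ⇓reg
   , ≤-trans
       (small-+ e 6
         (proj₂ (small (s≤s (nonempty x promise))
           (λ _ → ≤-trans (n≤1+n _) (≤-reflexive (sym (^-identityʳ _))))
           (λ a → ≤-trans (cells≤1 (code x) a) (m^n>0 (1 + length (code x)) 1))))
         (small-con 6))
       (≤-reflexive (sym (+-identityʳ _)))
   , mk⇔
       (λ accepting → Equivalence.to (correct x promise)
         λ v≡0 → 0≢1+n (trans (cong (λ v → 1 ∸ (1 ∸ v)) (sym v≡0)) (trans (sym v≡) accepting)))
       (λ yes → trans v≡ (positive (Equivalence.from (correct x promise) yes)))
  where
  open Computes
  normalised = lit 1 ⊖ (lit 1 ⊖ reg 1)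
  positive : ∀ {v} → v ≢ 0 → 1 ∸ (1 ∸ v) ≡ 1
  positive {zero}  v≢0 = ⊥-elim (v≢0 refl)
  positive {suc v} _   = cong (1 ∸_) (0∸n≡0 v)

-- Conflict-free 2-colourings of joins

Unique : {A : Set} → (A → Set) → Set
Unique P = ∃[ w ] P w × (∀ {w′} → P w′ → w′ ≡ w)

Unique-map : {A : Set} {P Q : A → Set} → (∀ {w} → P w ⇔ Q w) → Unique P → Unique Q
Unique-map P⇔Q (w , p , only) = w , to P⇔Q p , only ∘ from P⇔Q

Good : ∀ {n} → (Fin n → Fin n → Set) → (Fin n → Set) → Set
Good nb P = ∀ x → Unique (λ w → nb x w × P w) ⊎ Unique (λ w → nb x w × ¬ P w)

Pair : ∀ {n} → Fin n → Fin n → Fin n → Set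
Pair u v w = w ≡ u ⊎ w ≡ v

Punctured : ∀ {n} → Graph n → Fin n → Fin n → Fin n → Set
Punctured G u v w = adj G u w ≡ true × w ≢ v

TwoColourable : ∀ {n} → Graph n → (Fin n → Fin n → Set) → Set
TwoColourable G nb = ∃[ u ] ∃[ v ] (Good nb (Pair u v) ⊎ Good nb (Punctured G u v))

either : ∀ {c d : Bool} → c ≢ d → ∀ x → x ≡ c ⊎ x ≡ d
either {false} {false} c≢d x     = contradiction refl c≢d
either {true}  {true}  c≢d x     = contradiction refl c≢d
either {false} {true}  _   false = inj₁ refl
either {false} {true}  _   true  = inj₂ refl
either {true}  {false} _   false = inj₂ refl
either {true}  {false} _   true  = inj₁ refl

-- Works from a choice at each point, and so applies to the colours that vertices see without a
-- decision procedure for `Sees`.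
some-or-all : ∀ {n} {P Q : Fin n → Set} → (∀ i → P i ⊎ Q i) → ∃ P ⊎ (∀ i → Q i)
some-or-all {ℕ.zero}  P⊎Q = inj₂ λ ()
some-or-all {ℕ.suc n} P⊎Q with P⊎Q zero | some-or-all (P⊎Q ∘ suc)
... | inj₁ p | _            = inj₁ (zero , p)
... | inj₂ _ | inj₁ (i , p) = inj₁ (suc i , p)
... | inj₂ q | inj₂ qs      = inj₂ λ { zero → q ; (suc i) → qs i }

-- Closed and open neighbourhoods are treated together: `nb` contains adjacency, and `self` says
-- whether it is reflexive or consists of edges only. The distinction matters only at the end of
-- `opposite`.
module TwoColours {n : ℕ} (G : Graph n) (nb : Fin n → Fin n → Set)
  (adj⇒nb : ∀ {x w} → adj G x w ≡ true → nb x w)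
  (self   : (∀ x → nb x x) ⊎ (∀ {x w} → nb x w → adj G x w ≡ true))
  (side   : Fin n → Bool)
  (join   : ∀ {x w} → side x ≢ side w → adj G x w ≡ true)
  (R      : Fin n → Bool)
  where

  Sees : Bool → Fin n → Set
  Sees c x = Unique (λ w → nb x w × R w ≡ c)

  across : ∀ {t f x w} → t ≢ f → side x ≡ t → side w ≡ f → adj G x w ≡ true
  across t≢f refl refl = join t≢f

  module _ (sees : ∀ {c d} → c ≢ d → ∀ x → Sees c x ⊎ Sees d x) where

    good : ∀ {c d P} → c ≢ d → (∀ {w} → R w ≡ c ⇔ P w) → Good nb P
    good {c} {d} {P} c≢d class x with sees c≢d x
    ... | inj₁ u = inj₁ (Unique-map (λ {w} → mk⇔
            (λ (p , q) → p , to class q) (λ (p , q) → p , from class q)) u)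
    ... | inj₂ u = inj₂ (Unique-map (λ {w} → mk⇔
            (λ (p , q) → p , λ r → c≢d (trans (sym (from class r)) q))
            (λ (p , q) → p , other (λ r → q (to class r)))) u)
      where
      other : ∀ {w} → R w ≢ c → R w ≡ d
      other {w} R≢c with either c≢d (R w)
      ... | inj₁ e = contradiction e R≢c
      ... | inj₂ e = e

    Conclusion : Set
    Conclusion = (∀ x → Unique (nb x)) ⊎ TwoColourable G nb

    -- The vertex `a` sees the whole side of `b` and conversely, so each side has at most one vertex
    -- of colour `c`, and the class of `c` is a `Pair`, possibly with equal entries. If the class is
    -- empty, everything has colour `d` and neighbourhoods themselves are singletons.
    same-colour : ∀ {c d a b} → c ≢ d → side a ≡ true → side b ≡ false →
                  Sees c a → Sees c b → Conclusion
    same-colour {c} {d} {a} {b} c≢d a∈ b∈ (_ , _ , onlyᵃ) (_ , _ , onlyᵇ) =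
      by-cases (any? λ w → side w ≟ᵇ true ×-dec R w ≟ᵇ c)
               (any? λ w → side w ≟ᵇ false ×-dec R w ≟ᵇ c)
      where
      unique-false : ∀ {w w′} → side w ≡ false → R w ≡ c → side w′ ≡ false → R w′ ≡ c → w ≡ w′
      unique-false p q p′ q′ = trans
        (onlyᵃ (adj⇒nb (across (λ ()) a∈ p) , q)) (sym (onlyᵃ (adj⇒nb (across (λ ()) a∈ p′) , q′)))
      unique-true : ∀ {w w′} → side w ≡ true → R w ≡ c → side w′ ≡ true → R w′ ≡ c → w ≡ w′
      unique-true p q p′ q′ = trans
        (onlyᵇ (adj⇒nb (across (λ ()) b∈ p) , q)) (sym (onlyᵇ (adj⇒nb (across (λ ()) b∈ p′) , q′)))
      pair : ∀ {u v} → R u ≡ c → R v ≡ c →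
             (∀ {w} → side w ≡ true → R w ≡ c → Pair u v w) →
             (∀ {w} → side w ≡ false → R w ≡ c → Pair u v w) → Conclusion
      pair {u} {v} uc vc inside outside = inj₂ (u , v , inj₁ (good c≢d (λ {w} → mk⇔
        (λ wc → Sum.[ (λ e → inside e wc) , (λ e → outside e wc) ] (either (λ ()) (side w)))
        λ { (inj₁ refl) → uc ; (inj₂ refl) → vc })))
      by-cases : Dec (∃[ w ] side w ≡ true × R w ≡ c) → Dec (∃[ w ] side w ≡ false × R w ≡ c) →
               Conclusion
      by-cases (yes (p , p∈ , pc)) (yes (q , q∈ , qc)) = pair pc qc
        (λ e wc → inj₁ (unique-true e wc p∈ pc)) (λ e wc → inj₂ (unique-false e wc q∈ qc))
      by-cases (yes (p , p∈ , pc)) (no none) = pair pc pc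
        (λ e wc → inj₁ (unique-true e wc p∈ pc)) (λ e wc → contradiction (_ , e , wc) none)
      by-cases (no none) (yes (q , q∈ , qc)) = pair qc qc
        (λ e wc → contradiction (_ , e , wc) none) (λ e wc → inj₂ (unique-false e wc q∈ qc))
      by-cases (no noneᵃ) (no noneᵇ) = inj₁ everywhere
        where
        never : ∀ w → R w ≢ c
        never w wc with either {true} {false} (λ ()) (side w)
        ... | inj₁ e = noneᵃ (w , e , wc)
        ... | inj₂ e = noneᵇ (w , e , wc)
        always : ∀ w → R w ≡ d
        always w with either c≢d (R w)
        ... | inj₁ e = contradiction e (never w)
        ... | inj₂ e = e
        everywhere : ∀ x → Unique (nb x)
        everywhere x with sees c≢d x
        ... | inj₁ (w , (_ , wc) , _) = contradiction wc (never w)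
        ... | inj₂ u = Unique-map (λ {w} → mk⇔ proj₁ (λ p → p , always w)) u

    -- All vertices of colour `c` lie on the side opposite to `b`, hence are neighbours of `b`; and
    -- the only neighbour of `b` with colour `d` is `y`. So the class of `c` is the neighbourhood of
    -- `b` without `y`.
    monochromatic-side : ∀ {t f c d b} → t ≢ f → c ≢ d → side b ≡ f → Sees d b →
      (∀ w → side w ≡ f → R w ≢ c) → TwoColourable G nb
    monochromatic-side {t} {f} {c} {d} {b} t≢f c≢d b∈ (y , (_ , yd) , only) none =
      b , y , inj₂ (good c≢d (λ {w} → mk⇔ (forward w) (backward w)))
      where
      forward : ∀ w → R w ≡ c → adj G b w ≡ true × w ≢ y
      forward w wc with either t≢f (side w)
      ... | inj₁ e = across (t≢f ∘ sym) b∈ e , λ { refl → c≢d (trans (sym wc) yd) }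
      ... | inj₂ e = contradiction wc (none w e)
      backward : ∀ w → adj G b w ≡ true × w ≢ y → R w ≡ c
      backward w (bw , w≢y) with either c≢d (R w)
      ... | inj₁ e = e
      ... | inj₂ e = contradiction (only (adj⇒nb bw , e)) w≢y

    module Opposite {t f c d p q} (t≢f : t ≢ f) (c≢d : c ≢ d)
      (seesᵃ : ∀ x → side x ≡ t → Sees c x) (seesᵇ : ∀ x → side x ≡ f → Sees d x)
      (p∈ : side p ≡ f) (pc : R p ≡ c) (q∈ : side q ≡ t) (qd : R q ≡ d) where

      only-p : ∀ {x w} → side x ≡ t → nb x w → R w ≡ c → w ≡ p
      only-p x∈ xw wc with seesᵃ _ x∈
      ... | _ , _ , only = trans (only (xw , wc)) (sym (only (adj⇒nb (across t≢f x∈ p∈) , pc)))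

      only-q : ∀ {x w} → side x ≡ f → nb x w → R w ≡ d → w ≡ q
      only-q x∈ xw wd with seesᵇ _ x∈
      ... | _ , _ , only = trans (only (xw , wd))
        (sym (only (adj⇒nb (across (t≢f ∘ sym) x∈ q∈) , qd)))

      closed : (∀ x → nb x x) → Good nb (Pair p p)
      closed refl-nb = good c≢d (λ {w} → mk⇔ (forward w) λ { (inj₁ refl) → pc ; (inj₂ refl) → pc })
        where
        forward : ∀ w → R w ≡ c → w ≡ p ⊎ w ≡ p
        forward w wc with either t≢f (side w)
        -- On side `t`, `w` sees itself; on side `f`, it is seen by `q`. Either way its colour `c`
        -- forces it to be `p`.
        ... | inj₁ e = inj₁ (only-p e (refl-nb w) wc)
        ... | inj₂ e = inj₁ (only-p q∈ (adj⇒nb (across t≢f q∈ e)) wc)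

      module _ (nb⇒adj : ∀ {x w} → nb x w → adj G x w ≡ true) where

        -- A neighbour `x` of `q` on the side of `q` has no possible colour: with `c` it would be
        -- the vertex `p` of the other side, and with `d` it would be seen by `p` and so equal `q`,
        -- a loop.
        not-q : ∀ {x} → side x ≡ t → ¬ nb x q
        not-q {x} x∈ xq with either c≢d (R x)
        ... | inj₁ e = t≢f (trans (sym x∈) (trans (cong side
                (only-p q∈ (adj⇒nb (trans (adj-sym G q x) (nb⇒adj xq))) e)) p∈))
        ... | inj₂ e with only-q p∈ (adj⇒nb (across (t≢f ∘ sym) p∈ x∈)) e
        ...   | refl with trans (sym (nb⇒adj xq)) (adj-irrefl G q)
        ...     | ()

        open-side : ∀ x → side x ≡ t → Unique (λ w → nb x w × Pair p q w)
        open-side x x∈ = p , (adj⇒nb (across t≢f x∈ p∈) , inj₁ refl) ,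
          λ { (_ , inj₁ e) → e ; (xq , inj₂ refl) → contradiction xq (not-q x∈) }

    opposite : ∀ {c d a b} → c ≢ d → side a ≡ true → side b ≡ false →
      (∀ x → side x ≡ true → Sees c x) → (∀ x → side x ≡ false → Sees d x) →
      TwoColourable G nb
    opposite {c} {d} {a} {b} c≢d a∈ b∈ seesᵃ seesᵇ
      with any? (λ w → side w ≟ᵇ false ×-dec R w ≟ᵇ c)
         | any? (λ w → side w ≟ᵇ true ×-dec R w ≟ᵇ d)
    ... | no none | _ =
      monochromatic-side {true} (λ ()) c≢d b∈ (seesᵇ b b∈) λ w e wc → none (w , e , wc)
    ... | yes _ | no none =
      monochromatic-side {false} (λ ()) (c≢d ∘ sym) a∈ (seesᵃ a a∈) λ w e wc → none (w , e , wc)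
    ... | yes (p , p∈ , pc) | yes (q , q∈ , qd) = conclude self
      where
      module Here  = Opposite (λ ()) c≢d seesᵃ seesᵇ p∈ pc q∈ qd
      module There = Opposite (λ ()) (c≢d ∘ sym) seesᵇ seesᵃ q∈ qd p∈ pc
      conclude : _ → TwoColourable G nb
      conclude (inj₁ nb-refl) = p , p , inj₁ (Here.closed nb-refl)
      -- This may be a new colouring: in the class consisting of `p` and `q`, every vertex sees only
      -- the member on the opposite side.
      conclude (inj₂ nb⇒adj)  = p , q , inj₁ λ x → inj₁ (sees-one x (either (λ ()) (side x)))
        where
        sees-one : ∀ x → side x ≡ true ⊎ side x ≡ false → Unique (λ w → nb x w × Pair p q w)
        sees-one x (inj₁ e) = Here.open-side nb⇒adj x e
        sees-one x (inj₂ e) = Unique-map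
          (mk⇔ (λ (p , q) → p , Sum.swap q) (λ (p , q) → p , Sum.swap q))
          (There.open-side nb⇒adj x e)

    -- Let `a` see `c`. If some vertex opposite sees `c` too, or if all of them see `d` and some
    -- vertex on the side of `a` also sees `d`, then `same-colour` applies; otherwise the sides see
    -- opposite colours throughout.
    two-colours : ∀ {a b} → side a ≡ true → side b ≡ false → Conclusion
    two-colours {a} {b} a∈ b∈ =
      Sum.[ from-colour {true} {false} (λ ()) , from-colour {false} {true} (λ ()) ]
        (sees (λ ()) a)
      where
      on-side : ∀ {c d} t → c ≢ d → ∀ w →
                (side w ≡ t × Sees c w) ⊎ (side w ≡ t → Sees d w)
      on-side t c≢d w with side w ≟ᵇ t
      ... | no  e = inj₂ λ e′ → contradiction e′ e
      ... | yes e = Sum.map (e ,_) (λ u _ → u) (sees c≢d w)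
      from-colour : ∀ {c d} → c ≢ d → Sees c a → Conclusion
      from-colour {c} {d} c≢d ac with some-or-all (on-side false c≢d)
      ... | inj₁ (w , w∈ , wc) = same-colour c≢d a∈ w∈ ac wc
      ... | inj₂ seesᵇ with some-or-all (on-side true (c≢d ∘ sym))
      ...   | inj₁ (w , w∈ , wd) = same-colour (c≢d ∘ sym) w∈ b∈ wd (seesᵇ b b∈)
      ...   | inj₂ seesᵃ         = inj₂ (opposite c≢d a∈ b∈ seesᵃ seesᵇ)

-- Connected cographs are joins

Edges : ℕ → Set
Edges n = Fin n → Fin n → Bool

-- Invariant under complementation: the complement of an induced path is one.

NoAlternation : ∀ {n} → Edges n → Set
NoAlternation E = ∀ {c d} → c ≢ d → ∀ w x y z →
  E w x ≡ c → E x y ≡ c → E y z ≡ c → E w y ≡ d → E w z ≡ d → E x z ≡ d → ⊥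

record Split {n} (E : Edges n) : Set where
  field
    side    : Fin n → Bool
    value   : Bool
    left    : Fin n
    right   : Fin n
    left∈   : side left ≡ true
    right∈  : side right ≡ false
    uniform : ∀ {u v} → side u ≢ side v → E u v ≡ value

both-ways : ∀ {n} {E : Edges n} {side : Fin n → Bool} {value} → (∀ u v → E u v ≡ E v u) →
  (∀ {u v} → side u ≡ true → side v ≡ false → E u v ≡ value) →
  ∀ {u v} → side u ≢ side v → E u v ≡ value
both-ways {side = side} E-sym uniform {u} {v} u≢v with side u in eu | side v in ev
... | true  | true  = contradiction refl u≢v
... | false | false = contradiction refl u≢v
... | true  | false = uniform eu ev
... | false | true  = trans (E-sym u v) (uniform ev eu)

does-true : ∀ {P : Set} (P? : Dec P) → does P? ≡ true → P
does-true (yes p) _ = p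

does-false : ∀ {P : Set} (P? : Dec P) → does P? ≡ false → ¬ P
does-false (no ¬p) _ = ¬p

-- Induction, adding vertex 0 to a split of the rest. If 0 is related by `value` to one whole side,
-- it joins the other side; if it is related by `not value` to all vertices, it is split off alone.
-- Otherwise 0 together with the vertices related to it by `not value` forms a side, again with
-- `value` across.
split : ∀ n (E : Edges (2+ n)) → (∀ u v → E u v ≡ E v u) → NoAlternation E → Split E
split ℕ.zero E E-sym no-alt = record
  { side = true ∷ˢ false ∷ˢ λ () ; value = E 0F 1F ; left = 0F ; right = 1F
  ; left∈ = refl ; right∈ = refl
  ; uniform = both-ways E-sym λ { {0F} {0F} _ () ; {0F} {1F} _ _ → refl ; {1F} () _ } }
split (ℕ.suc n) E E-sym no-alt =
  extend (some-or-all (on-side true)) (some-or-all (on-side false)) (some-or-all (Sum.swap ∘ known))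
  where
  open Split (split n (λ u v → E (suc u) (suc v)) (λ u v → E-sym (suc u) (suc v))
    λ c≢d w x y z → no-alt c≢d (suc w) (suc x) (suc y) (suc z))
  F : Fin (2+ n) → Bool
  F u = E 0F (suc u)
  flip≢ : not value ≢ value
  flip≢ = not-¬ refl ∘ sym
  known : ∀ u → F u ≡ not value ⊎ F u ≡ value
  known u = either flip≢ (F u)
  on-side : ∀ s u → (side u ≡ s × F u ≡ not value) ⊎ (side u ≡ s → F u ≡ value)
  on-side s u with side u ≟ᵇ s
  ... | no  e = inj₂ λ e′ → contradiction e′ e
  ... | yes e = Sum.map (e ,_) (λ q _ → q) (known u)
  ≢-sides : ∀ {u v} → side u ≡ true → side v ≡ false → side u ≢ side v
  ≢-sides p q e = case trans (sym p) (trans e q) of λ ()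
  extend : ∃ (λ u → side u ≡ true × F u ≡ not value) ⊎ (∀ u → side u ≡ true → F u ≡ value) →
           ∃ (λ u → side u ≡ false × F u ≡ not value) ⊎ (∀ u → side u ≡ false → F u ≡ value) →
           ∃ (λ u → F u ≡ value) ⊎ (∀ u → F u ≡ not value) →
           Split E
  extend (inj₂ all) _ _ = record
    { side = false ∷ˢ side ; value = value ; left = suc left ; right = suc right
    ; left∈ = left∈ ; right∈ = right∈
    ; uniform = both-ways E-sym λ { {zero} () _
                  ; {suc u} {zero}  p q → trans (E-sym _ _) (all u p)
                  ; {suc u} {suc v} p q → uniform (≢-sides p q) } }
  extend _ (inj₂ all) _ = record
    { side = true ∷ˢ side ; value = value ; left = suc left ; right = suc right
    ; left∈ = left∈ ; right∈ = right∈
    ; uniform = both-ways E-sym λ { {_} {zero} _ ()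
                  ; {zero}  {suc v} p q → all v q
                  ; {suc u} {suc v} p q → uniform (≢-sides p q) } }
  extend _ _ (inj₂ all) = record
    { side = true ∷ˢ λ _ → false ; value = not value ; left = zero ; right = suc left
    ; left∈ = refl ; right∈ = refl
    ; uniform = both-ways E-sym λ { {_} {zero} _ () ; {zero} {suc v} p q → all v ; {suc u} () _ } }
  extend (inj₁ (y , y∈ , Fy)) (inj₁ (z , z∈ , Fz)) (inj₁ (w , Fw)) = record
    { side = true ∷ˢ (λ u → does (F u ≟ᵇ not value)) ; value = value ; left = zero ; right = suc w
    ; left∈ = refl ; right∈ = dec-false (F w ≟ᵇ not value) (λ e → flip≢ (trans (sym e) Fw))
    ; uniform = both-ways E-sym λ { {_} {zero} _ ()
                  ; {zero}  {suc v} p q → non-neighbour (does-false (F v ≟ᵇ _) q)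
                  ; {suc u} {suc v} p q → closed (does-true (F u ≟ᵇ _) p)
                                                 (non-neighbour (does-false (F v ≟ᵇ _) q)) } }
    where
    non-neighbour : ∀ {v} → F v ≢ not value → F v ≡ value
    non-neighbour {v} F≢ = Sum.fromInj₂ (λ e → contradiction e F≢) (known v)
    -- Both old sides contain a vertex related to 0 by `not value`, so one is available opposite to
    -- any `u`.
    elsewhere : ∀ u → ∃[ x ] side x ≢ side u × F x ≡ not value
    elsewhere u with side u
    ... | true  = z , (λ e → case trans (sym e) z∈ of λ ()) , Fz
    ... | false = y , (λ e → case trans (sym e) y∈ of λ ()) , Fy
    -- Otherwise x, 0, u, v is an alternation for some x on the side opposite to u.

    closed : ∀ {u v} → F u ≡ not value → F v ≡ value → E (suc u) (suc v) ≡ value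
    closed {u} {v} Fu Fv with side u ≟ᵇ side v | either flip≢ (E (suc u) (suc v)) | elsewhere u
    ... | no u≢v | _      | _             = uniform u≢v
    ... | yes _  | inj₂ e | _             = e
    ... | yes s  | inj₁ e | x , x≢u , Fx = ⊥-elim (no-alt flip≢ (suc x) zero (suc u) (suc v)
      (trans (E-sym _ _) Fx) Fu e (uniform x≢u) (uniform (subst (side x ≢_) s x≢u)) Fv)

-- Gives injectivity of the embedding for free: indices with the same image have the same rows in
-- the adjacency matrix. The finite check is done by evaluation.
P₄-twin-free : ∀ i j → (∀ l → adj P₄ i l ≡ adj P₄ j l) → i ≡ j
P₄-twin-free = from-yes (all? λ i → all? λ j →
  all? (λ l → adj P₄ i l ≟ᵇ adj P₄ j l) →-dec (i ≟ j))

module _ {n} (G : Graph n) where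

  private E = adj G

  induced-P₄ : ∀ w x y z → E w x ≡ true → E x y ≡ true → E y z ≡ true →
               E w y ≡ false → E w z ≡ false → E x z ≡ false → InducedSubgraph P₄ G
  induced-P₄ w x y z wx xy yz wy wz xz = f , injective , preserves
    where
    f : Fin 4 → Fin n
    f = w ∷ˢ x ∷ˢ y ∷ˢ z ∷ˢ λ ()
    flip : ∀ {u v b} → E u v ≡ b → E v u ≡ b
    flip {u} {v} = trans (adj-sym G v u)
    preserves : ∀ i j → E (f i) (f j) ≡ adj P₄ i j
    preserves 0F = λ { 0F → adj-irrefl G w ; 1F → wx ; 2F → wy ; 3F → wz }
    preserves 1F = λ { 0F → flip wx ; 1F → adj-irrefl G x ; 2F → xy ; 3F → xz }
    preserves 2F = λ { 0F → flip wy ; 1F → flip xy ; 2F → adj-irrefl G y ; 3F → yz }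
    preserves 3F = λ { 0F → flip wz ; 1F → flip xz ; 2F → flip yz ; 3F → adj-irrefl G z }
    injective : ∀ {i j} → f i ≡ f j → i ≡ j
    injective {i} {j} e = P₄-twin-free i j λ l →
      trans (sym (preserves i l)) (trans (cong (λ u → E u (f l)) e) (preserves j l))

  -- The complement of a path w x y z is the path y w z x.

  cograph-no-alternation : Cograph G → NoAlternation E
  cograph-no-alternation P₄-free {false} {false} c≢d = contradiction refl c≢d
  cograph-no-alternation P₄-free {true}  {true}  c≢d = contradiction refl c≢d
  cograph-no-alternation P₄-free {true}  {false} _ w x y z wx xy yz wy wz xz =
    P₄-free (induced-P₄ w x y z wx xy yz wy wz xz)
  cograph-no-alternation P₄-free {false} {true}  _ w x y z wx xy yz wy wz xz =
    P₄-free (induced-P₄ y w z x (flip wy) wz (flip xz) yz (flip xy) wx)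
    where
    flip : ∀ {u v b} → E u v ≡ b → E v u ≡ b
    flip {u} {v} = trans (adj-sym G v u)

  reachable-same-side : ∀ {side : Fin n → Bool} → (∀ {u v} → side u ≢ side v → E u v ≡ false) →
    ∀ {u v} → Star (Adjacent G) u v → side u ≡ side v
  reachable-same-side isolated ε = refl
  reachable-same-side {side} isolated (_◅_ {u} {v} uv rest) with side u ≟ᵇ side v
  ... | yes e = trans e (reachable-same-side isolated rest)
  ... | no  e = ⊥-elim (subst T (isolated e) uv)

-- A split without edges across would confine every path to one side, although `left` and `right`
-- are connected.
connected-cograph-join : ∀ {n} (G : Graph (2+ n)) → Connected G → Cograph G →
  ∃[ s ] (∀ {u v} → Split.side {E = adj G} s u ≢ Split.side s v → adj G u v ≡ true)
connected-cograph-join {n} G (_ , connected) P₄-free =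
  decomposition , λ u≢v → trans (uniform u≢v) value-true
  where
  decomposition = split n (adj G) (adj-sym G) (cograph-no-alternation G P₄-free)
  open Split decomposition
  value-true : value ≡ true
  value-true with value in e
  ... | true  = refl
  ... | false = case trans (sym left∈) (trans same right∈) of λ ()
    where same = reachable-same-side G (λ u≢v → trans (uniform u≢v) e) (connected left right)

-- Colourability of connected cographs

-- A second element would make a singleton a proper subset of `p`, and so force a larger
-- cardinality.
size-one : ∀ {n} {p : Subset n} → ∣ p ∣ ≡ 1 ⇔ Unique (_∈ p)
size-one {n} {p} = mk⇔ forward backward
  where
  forward : ∣ p ∣ ≡ 1 → Unique (_∈ p)
  forward one with nonempty? p
  ... | no  empty = case trans (sym one) (trans (cong ∣_∣ (Empty-unique empty)) (∣⊥∣≡0 n)) of λ ()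
  ... | yes (w , w∈p) = w , w∈p , only
    where
    only : ∀ {x} → x ∈ p → x ≡ w
    only {x} x∈p with x ≟ w
    ... | yes x≡w = x≡w
    ... | no  x≢w = contradiction (p⊂q⇒∣p∣<∣q∣ {p = ⁅ w ⁆}
      ((λ y∈ → subst (_∈ p) (sym (x∈⁅y⁆⇒x≡y w y∈)) w∈p) , x , x∈p , x≢y⇒x∉⁅y⁆ x≢w))
      (<-irrefl (trans (∣⁅x⁆∣≡1 w) (sym one)))
  backward : Unique (_∈ p) → ∣ p ∣ ≡ 1
  backward (w , w∈p , only) = trans
    (cong ∣_∣ (⊆-antisym (λ x∈p → subst (_∈ ⁅ w ⁆) (sym (only x∈p)) (x∈⁅x⁆ w))
                         (λ x∈ → subst (_∈ p) (sym (x∈⁅y⁆⇒x≡y w x∈)) w∈p)))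
    (∣⁅x⁆∣≡1 w)

∈-tabulate : ∀ {n} {f : Fin n → Bool} {w} → w ∈ Vec.tabulate f ⇔ f w ≡ true
∈-tabulate {f = f} {w} = mk⇔
  (λ w∈ → trans (sym (lookup∘tabulate f w)) ([]=⇒lookup w∈))
  (λ e → lookup⇒[]= w (Vec.tabulate f) (trans (lookup∘tabulate f w) e))

Open Closed : ∀ {n} → Graph n → Fin n → Fin n → Set
Open   G x w = adj G x w ≡ true
Closed G x w = adj G x w ≡ true ⊎ w ≡ x

∈-closed : ∀ {n} {G : Graph n} {x w} → w ∈ N[ G ] x ⇔ Closed G x w
∈-closed {G = G} {x} = mk⇔
  (Sum.map (to ∈-tabulate) (x∈⁅y⁆⇒x≡y x) ∘ x∈p∪q⁻ (N⟨ G ⟩ x) ⁅ x ⁆)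
  (x∈p∪q⁺ ∘ Sum.map (from ∈-tabulate) λ { refl → x∈⁅x⁆ x })

∈-class : ∀ {n k} {C : Colouring n k} {c w} → w ∈ colourClass C c ⇔ C w ≡ c
∈-class {C = C} {c} {w} = mk⇔
  (does-true (C w ≟ c) ∘ to ∈-tabulate)
  (from ∈-tabulate ∘ dec-true (C w ≟ c))

Colourable : ∀ {n} → (Fin n → Fin n → Set) → ℕ → Set
Colourable {n} nb k = ∃ λ (C : Colouring n k) → ∀ v → ∃[ c ] Unique (λ w → nb v w × C w ≡ c)

colourable : ∀ {n k} {nb : Fin n → Fin n → Set} {N : Fin n → Subset n} →
  (∀ {x w} → w ∈ N x ⇔ nb x w) →
  (∃ λ (C : Colouring n k) → ∀ v → HasUniqueColour C (N v)) ⇔ Colourable nb k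
colourable {n} {k} {nb} {N} ∈N⇔nb = mk⇔
  (λ (C , u) → C , λ v → let c , one = u v in c , Unique-map (in-class C) (to size-one one))
  (λ (C , u) → C , λ v →
    let c , one = u v in c , from size-one (Unique-map (⇔-sym (in-class C)) one))
  where
  in-class : ∀ (C : Colouring n k) {v c w} → w ∈ N v ∩ colourClass C c ⇔ (nb v w × C w ≡ c)
  in-class C {v} {c} = mk⇔
    (Product.map (to ∈N⇔nb) (to (∈-class {C = C})) ∘ x∈p∩q⁻ (N v) (colourClass C c))
    (x∈p∩q⁺ ∘ Product.map (from ∈N⇔nb) (from (∈-class {C = C})))

-- The alternatives are three colours on a join, a 2-colouring of one of the listed shapes, and a
-- constant colouring. The condition `2 ≤ n` excludes the single vertex, whose open neighbourhood is
-- empty and has no unique colour for any `k`.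
Criterion : ∀ {n} → Graph n → (Fin n → Fin n → Set) → ℕ → Set
Criterion {n} G nb k =
  (3 ≤ k × 2 ≤ n) ⊎ (2 ≤ k × TwoColourable G nb) ⊎ (1 ≤ k × (∀ x → Unique (nb x)))

module _ {n : ℕ} (G : Graph n) (nb : Fin n → Fin n → Set)
  (adj⇒nb : ∀ {x w} → adj G x w ≡ true → nb x w) where

  good-colourable : ∀ {k P} → Decidable P → Good nb P → Colourable nb (2+ k)
  good-colourable {k} {P} P? good = C , sees
    where
    C : Colouring n (2+ k)
    C w = if does (P? w) then 0F else 1F
    class₀ : ∀ {w} → P w ⇔ C w ≡ 0F
    class₀ {w} with P? w
    ... | yes p = mk⇔ (λ _ → refl) (λ _ → p)
    ... | no ¬p = mk⇔ (λ p → contradiction p ¬p) (λ ())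
    class₁ : ∀ {w} → (¬ P w) ⇔ C w ≡ 1F
    class₁ {w} with P? w
    ... | yes p = mk⇔ (λ ¬p → contradiction p ¬p) (λ ())
    ... | no ¬p = mk⇔ (λ _ → refl) (λ _ → ¬p)
    sees : ∀ v → ∃[ c ] Unique (λ w → nb v w × C w ≡ c)
    sees v with good v
    ... | inj₁ u = 0F , Unique-map (mk⇔ (Product.map₂ (to class₀)) (Product.map₂ (from class₀))) u
    ... | inj₂ u = 1F , Unique-map (mk⇔ (Product.map₂ (to class₁)) (Product.map₂ (from class₁))) u

  three-colourable : (s : Split (adj G)) →
    (∀ {u v} → Split.side s u ≢ Split.side s v → adj G u v ≡ true) →
    ∀ {k} → Colourable nb (suc (2+ k))
  three-colourable s join {k} = C , sees
    where
    open Split s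
    C : Colouring n (suc (2+ k))
    C w = if does (w ≟ left) then 0F else if does (w ≟ right) then 1F else 2F
    C-left : C left ≡ 0F
    C-left rewrite dec-true (left ≟ left) refl = refl
    right≢left : right ≢ left
    right≢left refl = case trans (sym left∈) right∈ of λ ()
    C-right : C right ≡ 1F
    C-right rewrite dec-false (right ≟ left) right≢left | dec-true (right ≟ right) refl = refl
    C-0 : ∀ {w} → C w ≡ 0F → w ≡ left
    C-0 {w} e with w ≟ left | w ≟ right
    C-0 e  | yes p | _     = p
    C-0 () | no _  | yes _
    C-0 () | no _  | no _
    C-1 : ∀ {w} → C w ≡ 1F → w ≡ right
    C-1 {w} e with w ≟ left | w ≟ right
    C-1 () | yes _ | _
    C-1 e  | no _  | yes p = p
    C-1 () | no _  | no _
    sees : ∀ v → ∃[ c ] Unique (λ w → nb v w × C w ≡ c)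
    sees v with side v in e
    ... | true  = 1F , right , (adj⇒nb (join crossing) , C-right) , C-1 ∘ proj₂
      where
      crossing : side v ≢ side right
      crossing e′ = case trans (sym e) (trans e′ right∈) of λ ()
    ... | false = 0F , left , (adj⇒nb (join crossing) , C-left) , C-0 ∘ proj₂
      where
      crossing : side v ≢ side left
      crossing e′ = case trans (sym e) (trans e′ left∈) of λ ()

  two-colouring : (self : (∀ x → nb x x) ⊎ (∀ {x w} → nb x w → adj G x w ≡ true)) →
    (s : Split (adj G)) → (∀ {u v} → Split.side s u ≢ Split.side s v → adj G u v ≡ true) →
    Colourable nb 2 → (∀ x → Unique (nb x)) ⊎ TwoColourable G nb
  two-colouring self s join (C , u) = two-colours sees left∈ right∈
    where
    open Split s
    R : Fin n → Bool
    R w = does (C w ≟ 0F)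
    open TwoColours G nb adj⇒nb self side join R
    colour : Bool → Fin 2
    colour b = if b then 0F else 1F
    class : ∀ {w} b → C w ≡ colour b ⇔ R w ≡ b
    class {w} b with C w
    class true  | 0F = mk⇔ (λ _ → refl) (λ _ → refl)
    class true  | 1F = mk⇔ (λ ()) (λ ())
    class false | 0F = mk⇔ (λ ()) (λ ())
    class false | 1F = mk⇔ (λ _ → refl) (λ _ → refl)
    colour-onto : ∀ c → ∃[ b ] c ≡ colour b
    colour-onto 0F = true , refl
    colour-onto 1F = false , refl
    sees-some : ∀ x → ∃[ b ] Sees b x
    sees-some x with u x
    ... | c , unique with colour-onto c
    ... | b , refl = b , Unique-map
      (mk⇔ (Product.map₂ (to (class b))) (Product.map₂ (from (class b)))) unique
    sees : ∀ {c d} → c ≢ d → ∀ x → Sees c x ⊎ Sees d x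
    sees c≢d x with sees-some x
    ... | b , unique with either c≢d b
    ... | inj₁ refl = inj₁ unique
    ... | inj₂ refl = inj₂ unique

fin1-unique : ∀ (u v : Fin 1) → u ≡ v
fin1-unique 0F 0F = refl

criterion : ∀ {n k} (G : Graph n) (nb : Fin n → Fin n → Set) →
  (∀ {x w} → adj G x w ≡ true → nb x w) →
  ((∀ x → nb x x) ⊎ (∀ {x w} → nb x w → adj G x w ≡ true)) →
  Connected G → Cograph G → Colourable nb k ⇔ Criterion G nb k
criterion {n} {k} G nb adj⇒nb self connected P₄-free =
  mk⇔ (complete n k G nb adj⇒nb self connected P₄-free) sound
  where
  complete : ∀ n k (G : Graph n) (nb : Fin n → Fin n → Set) →
    (∀ {x w} → adj G x w ≡ true → nb x w) →
    ((∀ x → nb x x) ⊎ (∀ {x w} → nb x w → adj G x w ≡ true)) →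
    Connected G → Cograph G → Colourable nb k → Criterion G nb k
  complete zero k G nb _ _ (nonzero , _) = contradiction refl (≢-nonZero⁻¹ 0 {{nonzero}})
  complete (suc n) zero G nb _ _ _ _ (C , _) = case C 0F of λ ()
  complete 1 (suc k) G nb _ _ _ _ (C , u) = inj₂ (inj₂ (s≤s z≤n , λ x →
    let c , w , (xw , _) , _ = u x in w , xw , λ {w′} _ → fin1-unique w′ w))
  complete (2+ n) 1 G nb _ _ _ _ (C , u) = inj₂ (inj₂ (s≤s z≤n , λ x →
    let c , w , (xw , _) , only = u x in w , xw , λ {w′} xw′ → only (xw′ , fin1-unique (C w′) c)))
  complete (2+ n) 2 G nb adj⇒nb self connected P₄-free colouring =
    let s , join = connected-cograph-join G connected P₄-free in
    Sum.[ (λ all → inj₂ (inj₂ (s≤s z≤n , all))) , (λ two → inj₂ (inj₁ (s≤s (s≤s z≤n) , two))) ]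
      (two-colouring G nb adj⇒nb self s join colouring)
  complete (2+ n) (suc (2+ k)) G nb _ _ _ _ _ = inj₁ (s≤s (s≤s (s≤s z≤n)) , s≤s (s≤s z≤n))
  sound : Criterion G nb k → Colourable nb k
  sound (inj₁ (s≤s (s≤s (s≤s z≤n)) , s≤s (s≤s z≤n))) =
    let s , join = connected-cograph-join G connected P₄-free in
    three-colourable G nb adj⇒nb s join
  sound (inj₂ (inj₁ (s≤s (s≤s z≤n) , u , v , inj₁ good))) =
    good-colourable G nb adj⇒nb (λ w → w ≟ u ⊎-dec w ≟ v) good
  sound (inj₂ (inj₁ (s≤s (s≤s z≤n) , u , v , inj₂ good))) =
    good-colourable G nb adj⇒nb (λ w → adj G u w ≟ᵇ true ×-dec ¬? (w ≟ v)) good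
  sound (inj₂ (inj₂ (s≤s z≤n , all))) =
    (λ _ → 0F) , λ x → 0F , Unique-map (mk⇔ (_, refl) proj₁) (all x)

-- The decision procedure as a term

infix 0 _⊨_

-- A number represents a truth value, zero being false.

_⊨_ : ℕ → Set → Set
m ⊨ P = m ≢ 0 ⇔ P

⊨-⇔ : ∀ {m P Q} → P ⇔ Q → m ⊨ P → m ⊨ Q
⊨-⇔ P⇔Q r = mk⇔ (to P⇔Q ∘ to r) (from r ∘ from P⇔Q)

¬-⊨ : ∀ {m P} → m ⊨ P → 1 ∸ m ⊨ ¬ P
¬-⊨ {zero}  r = mk⇔ (λ _ p → from r p refl) (λ _ ())
¬-⊨ {suc m} r = mk⇔ (λ ≢0 → contradiction (0∸n≡0 m) ≢0) (λ ¬p → contradiction (to r λ ()) ¬p)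

⊎-⊨ : ∀ {m n P Q} → m ⊨ P → n ⊨ Q → m + n ⊨ P ⊎ Q
⊎-⊨ {zero}  r s = mk⇔ (inj₂ ∘ to s) Sum.[ (λ p → contradiction refl (from r p)) , from s ]
⊎-⊨ {suc m} r s = mk⇔ (λ _ → inj₁ (to r λ ())) (λ _ ())

-- De Morgan: negation is subtraction from 1 and disjunction is addition.
×-⊨ : ∀ {m n P Q} → m ⊨ P → n ⊨ Q → 1 ∸ ((1 ∸ m) + (1 ∸ n)) ⊨ P × Q
×-⊨ {zero}  {n}     r s = mk⇔ (λ ≢0 → contradiction (0∸n≡0 (1 ∸ n)) ≢0)
                            (λ (p , _) → contradiction refl (from r p))
×-⊨ {suc m} {zero}  r s rewrite 0∸n≡0 m =
  mk⇔ (λ ≢0 → contradiction refl ≢0) (λ (_ , q) → contradiction refl (from s q))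
×-⊨ {suc m} {suc n} r s rewrite 0∸n≡0 m | 0∸n≡0 n =
  mk⇔ (λ _ → to r (λ ()) , to s λ ()) (λ _ ())

≡-⊨ : ∀ m n → 1 ∸ ((m ∸ n) + (n ∸ m)) ⊨ m ≡ n
≡-⊨ m n = mk⇔ forward backward
  where
  forward : 1 ∸ ((m ∸ n) + (n ∸ m)) ≢ 0 → m ≡ n
  forward ≢0 with (m ∸ n) + (n ∸ m) in e
  ... | zero  = ≤-antisym (m∸n≡0⇒m≤n (m+n≡0⇒m≡0 (m ∸ n) e)) (m∸n≡0⇒m≤n (m+n≡0⇒n≡0 (m ∸ n) e))
  ... | suc j = contradiction (0∸n≡0 j) ≢0
  backward : m ≡ n → 1 ∸ ((m ∸ n) + (n ∸ m)) ≢ 0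
  backward refl rewrite n∸n≡0 m = λ ()

→-⊨ : ∀ {m n P Q} → m ⊨ P → n ⊨ Q → (1 ∸ m) + n ⊨ (P → Q)
→-⊨ {zero}  r s = mk⇔ (λ _ p → contradiction refl (from r p)) (λ _ ())
→-⊨ {suc m} r s rewrite 0∸n≡0 m = mk⇔ (λ ≢0 _ → to s ≢0) (λ f → from s (f (to r λ ())))

-- Bounded sums as quantifiers

∑-cong : ∀ n {f g : ℕ → ℕ} → (∀ {i} → i < n → f i ≡ g i) → ∑ n f ≡ ∑ n g
∑-cong zero    f≡g = refl
∑-cong (suc n) f≡g = cong₂ _+_ (f≡g ≤-refl) (∑-cong n (λ i<n → f≡g (m<n⇒m<1+n i<n)))

∑-const : ∀ n c → ∑ n (λ _ → c) ≡ n * c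
∑-const zero    c = refl
∑-const (suc n) c = cong (c +_) (∑-const n c)

∑-⊨ : ∀ n {f} → ∑ n f ⊨ ∃[ i ] i < n × f i ≢ 0
∑-⊨ zero    = mk⇔ (λ ≢0 → contradiction refl ≢0) (λ ())
∑-⊨ (suc n) {f} = ⊨-⇔
  (mk⇔ Sum.[ (λ e → n , ≤-refl , e) , (λ (i , i<n , e) → i , m<n⇒m<1+n i<n , e) ] split-last)
  (⊎-⊨ {f n} (mk⇔ id id) (∑-⊨ n {f}))
  where
  split-last : ∃[ i ] i < suc n × f i ≢ 0 → f n ≢ 0 ⊎ (∃[ i ] i < n × f i ≢ 0)
  split-last (i , i<1+n , e) with m<1+n⇒m<n∨m≡n i<1+n
  ... | inj₁ i<n  = inj₂ (i , i<n , e)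
  ... | inj₂ refl = inj₁ e

∃-⊨ : ∀ {m n f} {P : Fin n → Set} → m ≡ n → (∀ i → f (toℕ i) ⊨ P i) → ∑ m f ⊨ ∃ P
∃-⊨ {n = n} {f} refl r = ⊨-⇔ (mk⇔
  (λ (i , i<n , e) → fromℕ< i<n , to (r _) (subst (λ j → f j ≢ 0) (sym (toℕ-fromℕ< i<n)) e))
  (λ (i , p) → toℕ i , toℕ<n i , from (r i) p)) (∑-⊨ n {f})

-- Encoded as the absence of a counterexample. This is constructively sound because a proposition
-- represented by a number is stable under double negation.
∀-⊨ : ∀ {m n} {f : ℕ → ℕ} {P : Fin n → Set} → m ≡ n → (∀ i → f (toℕ i) ⊨ P i) →
      1 ∸ ∑ m (λ i → 1 ∸ f i) ⊨ (∀ i → P i)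
∀-⊨ {m} {f = f} m≡n r = ⊨-⇔ (mk⇔
  (λ none i → stable (f (toℕ i)) (r i) (λ ¬p → none (i , ¬p)))
  (λ all (i , ¬p) → ¬p (all i)))
  (¬-⊨ {∑ m (λ i → 1 ∸ f i)} (∃-⊨ m≡n (λ i → ¬-⊨ {f (toℕ i)} (r i))))
  where
  stable : ∀ m {Q} → m ⊨ Q → ¬ ¬ Q → Q
  stable zero    r ¬¬q = contradiction (λ q → from r q refl) ¬¬q
  stable (suc m) r _   = to r λ ()

-- The search written as a term

infixr 4 _andᵗ_
infixr 3 _orᵗ_ _impᵗ_
infix  6 _eqᵗ_

notᵗ : Term → Term
notᵗ a = con 1 ⊟ a

_andᵗ_ _orᵗ_ _impᵗ_ _eqᵗ_ : Term → Term → Term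
a andᵗ b = notᵗ (notᵗ a ⊞ notᵗ b)
a orᵗ  b = a ⊞ b
a impᵗ b = notᵗ a ⊞ b
a eqᵗ  b = notᵗ ((a ⊟ b) ⊞ (b ⊟ a))

allᵗ : ℕ → Term → Term → Term
allᵗ x a b = notᵗ (∑[ x < a ] notᵗ b)

-- The order is the number of positions up to which all bits are 1.
-- Variable 0 is never bound, so it denotes the length of the input.

order-of : Term
order-of = ∑[ 1 < var 0 ] allᵗ 2 (con 1 ⊞ var 1) (cell (var 2))

-- Entry `(x , y)` of the matrix follows the `n` unary bits, the separator and `x` full rows. The
-- product of `x` and `n` is a sum of `x` copies of `order-of`; `digitᵗ` skips all `n * n` entries
-- likewise.
adjacentᵗ : ℕ → ℕ → Term
adjacentᵗ x y = cell (order-of ⊞ (con 1 ⊞ ((∑[ 1 < var x ] order-of) ⊞ var y)))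

digitᵗ : Term → Term
digitᵗ a = cell (order-of ⊞ (con 1 ⊞ ((∑[ 1 < order-of ] order-of) ⊞ a)))

-- Cells behind the input contain 0, so the sum may run beyond its end.

positiveᵗ : ℕ → Term
positiveᵗ m = ∑[ 1 < var 0 ] digitᵗ (con m ⊞ var 1)

-- Variables are numbered globally: 2 and 3 describe the colour class, 4 is the vertex whose
-- neighbourhood is inspected, 5 the candidate and 6 its competitor. That `order-of` rebinds 1 and 2
-- is harmless, since it reads only variable 0 from outside.
uniqueᵗ : (ℕ → Term) → Term
uniqueᵗ P = ∑[ 5 < order-of ] (P 5 andᵗ allᵗ 6 order-of (P 6 impᵗ var 6 eqᵗ var 5))

module Algorithm (nbᵗ : ℕ → ℕ → Term) where

  goodᵗ : (ℕ → Term) → Term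
  goodᵗ P = allᵗ 4 order-of
    (uniqueᵗ (λ w → nbᵗ 4 w andᵗ P w) orᵗ uniqueᵗ (λ w → nbᵗ 4 w andᵗ notᵗ (P w)))

  pairᵗ puncturedᵗ : ℕ → Term
  pairᵗ      w = var w eqᵗ var 2 orᵗ var w eqᵗ var 3
  puncturedᵗ w = adjacentᵗ 2 w andᵗ notᵗ (var w eqᵗ var 3)

  criterionᵗ : Term
  criterionᵗ =
    ((positiveᵗ 2 orᵗ (positiveᵗ 1 andᵗ digitᵗ (con 0))) andᵗ (order-of ⊟ con 1))
    orᵗ (positiveᵗ 1 andᵗ (∑[ 2 < order-of ] ∑[ 3 < order-of ] (goodᵗ pairᵗ orᵗ goodᵗ puncturedᵗ)))
    orᵗ (positiveᵗ 0 andᵗ allᵗ 4 order-of (uniqueᵗ (nbᵗ 4)))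

-- Reading the encoded instance

∑-initial : ∀ m {n f} → n ≤ m → (∀ {i} → i < n → f i ≡ 1) → (∀ {i} → n ≤ i → f i ≡ 0) → ∑ m f ≡ n
∑-initial m {n} n≤m ones zeros with m≤n⇒m<n∨m≡n n≤m
∑-initial (suc m) n≤m ones zeros | inj₁ (s≤s n≤m′) =
  cong₂ _+_ (zeros n≤m′) (∑-initial m n≤m′ ones zeros)
∑-initial m n≤m ones zeros | inj₂ refl =
  trans (∑-cong m ones) (trans (∑-const m 1) (*-identityʳ m))

cells-++ : ∀ xs ys i → cells (xs ++ ys) (length xs + i) ≡ cells ys i
cells-++ []       ys i = refl
cells-++ (x ∷ xs) ys i = cells-++ xs ys i

cells-replicate : ∀ n ys {i} → i < n → cells (replicate n 1b ++ ys) i ≡ 1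
cells-replicate (suc n) ys {zero}  _         = refl
cells-replicate (suc n) ys {suc i} (s≤s i<n) = cells-replicate n ys i<n

cells-tabulate : ∀ {n} (f : Fin n → Bit) ys i → cells (tabulate f ++ ys) (toℕ i) ≡ toℕ (f i)
cells-tabulate f ys zero    = refl
cells-tabulate f ys (suc i) = cells-tabulate (f ∘ suc) ys i

matrix : ∀ {m n} → (Fin m → Fin n → Bit) → List Bit
matrix f = concat (tabulate λ u → tabulate (f u))

cells-row : ∀ {n} (f : Fin n → Bit) ys i → cells (tabulate f ++ ys) (n + i) ≡ cells ys i
cells-row f ys i = subst (λ l → cells (tabulate f ++ ys) (l + i) ≡ cells ys i)
  (length-tabulate f) (cells-++ (tabulate f) ys i)

cells-matrix : ∀ {m n} (f : Fin m → Fin n → Bit) ys u v →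
  cells (matrix f ++ ys) (toℕ u * n + toℕ v) ≡ toℕ (f u v)
cells-matrix {suc m} {n} f ys u v rewrite ++-assoc (tabulate (f zero)) (matrix (f ∘ suc)) ys with u
... | zero   = cells-tabulate (f zero) _ v
... | suc u′ rewrite +-assoc n (toℕ u′ * n) (toℕ v) =
  trans (cells-row (f zero) _ _) (cells-matrix (f ∘ suc) ys u′ v)

cells-after-matrix : ∀ {m n} (f : Fin m → Fin n → Bit) ys i →
  cells (matrix f ++ ys) (m * n + i) ≡ cells ys i
cells-after-matrix {zero}  f ys i = refl
cells-after-matrix {suc m} {n} f ys i
  rewrite ++-assoc (tabulate (f zero)) (matrix (f ∘ suc)) ys | +-assoc n (m * n) i =
  trans (cells-row (f zero) _ _) (cells-after-matrix (f ∘ suc) ys i)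

cells-drop : ∀ m ds i → cells ds (m + i) ≡ cells (drop m ds) i
cells-drop zero    ds       i = refl
cells-drop (suc m) []       i = refl
cells-drop (suc m) (d ∷ ds) i = cells-drop m ds i

positive-digits : ∀ (ds : List Bit) {l} → length ds ≤ l → ∑ l (cells ds) ⊨ 1 ≤ fromDigits ds
positive-digits ds {l} l≥ = ⊨-⇔ (mk⇔ (λ (i , _ , e) → forward ds i e)
  (λ p → let i , i< , e = backward ds p in i , <-≤-trans i< l≥ , e)) (∑-⊨ l {cells ds})
  where
  forward : ∀ (ds : List Bit) i → cells ds i ≢ 0 → 1 ≤ fromDigits ds
  forward []       i       e = contradiction refl e
  forward (d ∷ ds) zero    e = ≤-trans (n≢0⇒n>0 e) (m≤m+n (toℕ d) _)
  forward (d ∷ ds) (suc i) e =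
    ≤-trans (≤-trans (forward ds i e) (m≤m*n (fromDigits ds) 2)) (m≤n+m _ (toℕ d))
  backward : ∀ (ds : List Bit) → 1 ≤ fromDigits ds → ∃[ i ] i < length ds × cells ds i ≢ 0
  backward (1F ∷ ds) p = 0 , s≤s z≤n , λ ()
  backward (0F ∷ ds) p with fromDigits ds in e
  ... | suc _ = let i , i< , c = backward ds (subst (1 ≤_) (sym e) (s≤s z≤n)) in suc i , s≤s i< , c

two≤ : ∀ (ds : List Bit) → 1 ≤ fromDigits (drop 1 ds) ⇔ 2 ≤ fromDigits ds
two≤ []       = mk⇔ (λ ()) (λ ())
two≤ (d ∷ ds) with fromDigits ds
two≤ (0F ∷ ds) | zero  = mk⇔ (λ ()) (λ ())
two≤ (1F ∷ ds) | zero  = mk⇔ (λ ()) λ { (s≤s ()) }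
two≤ (d ∷ ds)  | suc m = mk⇔ (λ _ → ≤-trans (s≤s (s≤s z≤n)) (m≤n+m _ (toℕ d))) (λ _ → s≤s z≤n)

-- Dropping low bits divides by powers of two, rounding down. A number is at least 3 iff it is at
-- least 4, or is odd and at least 2.
three≤ : ∀ (ds : List Bit) →
  (1 ≤ fromDigits (drop 2 ds) ⊎ (1 ≤ fromDigits (drop 1 ds) × cells ds 0 ≢ 0)) ⇔ 3 ≤ fromDigits ds
three≤ []       = mk⇔ (λ { (inj₁ ()) ; (inj₂ ()) }) (λ ())
three≤ (d ∷ ds) = mk⇔
  Sum.[ (λ p → doubled d (to (two≤ ds) p)) , (λ (p , e) → odd d p e) ]
  (λ p → Sum.map₁ (from (two≤ ds)) (above d p))
  where
  doubled : ∀ (d : Bit) {m} → 2 ≤ m → 3 ≤ toℕ d + m * 2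
  doubled d {m} p = ≤-trans (≤-trans (n≤1+n 3) (*-monoˡ-≤ 2 p)) (m≤n+m _ (toℕ d))
  odd : ∀ (d : Bit) {m} → 1 ≤ m → toℕ d ≢ 0 → 3 ≤ toℕ d + m * 2
  odd 0F p e = contradiction refl e
  odd 1F p e = s≤s (*-monoˡ-≤ 2 p)
  above : ∀ (d : Bit) {m} → 3 ≤ toℕ d + m * 2 → 2 ≤ m ⊎ (1 ≤ m × toℕ d ≢ 0)
  above 0F {1}    (s≤s (s≤s ()))
  above 1F {zero} (s≤s ())
  above 1F {1}    p = inj₂ (s≤s z≤n , λ ())
  above d  {suc (suc m)} p = inj₁ (s≤s (s≤s z≤n))

-- The term expresses the criterion

module Reflection {n} (G : Graph n) (ds : List Bit) where

  entry : Fin n → Fin n → Bit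
  entry u v = bit (adj G u v)

  input : List Bit
  input = replicate n 1b ++ 0b ∷ matrix entry ++ ds

  μ : ℕ → ℕ
  μ = cells input

  len : ℕ
  len = length input

  n≤len : n ≤ len
  n≤len = subst (n ≤_)
    (sym (trans (length-++ (replicate n 1b))
      (cong (_+ length (0b ∷ matrix entry ++ ds)) (length-replicate n))))
    (m≤m+n n _)

  ds≤len : length ds ≤ len
  ds≤len = begin
    length ds                                 ≤⟨ m≤n+m _ (length (matrix entry)) ⟩
    length (matrix entry) + length ds         ≡⟨ length-++ (matrix entry) ⟨
    length (matrix entry ++ ds)               ≤⟨ n≤1+n _ ⟩
    1 + length (matrix entry ++ ds)           ≤⟨ m≤n+m _ (length (replicate n 1b)) ⟩
    length (replicate n 1b) + (1 + length (matrix entry ++ ds))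
                                              ≡⟨ length-++ (replicate n 1b) ⟨
    len                                       ∎
    where open ≤-Reasoning

  μ-unary : ∀ {i} → i < n → μ i ≡ 1
  μ-unary = cells-replicate n _

  μ-after : ∀ i → μ (n + i) ≡ cells (0b ∷ matrix entry ++ ds) i
  μ-after i = subst (λ l → μ (l + i) ≡ cells (0b ∷ matrix entry ++ ds) i)
    (length-replicate n) (cells-++ (replicate n 1b) (0b ∷ matrix entry ++ ds) i)

  infix 0 _∣_⊨_

  -- A record rather than a synonym, so that `η` and `t` can be recovered by unification, which the
  -- unfolding of `eval` would obstruct.
  record _∣_⊨_ (η : ℕ → ℕ) (t : Term) (P : Set) : Set where
    constructor reflects
    field reflected : eval t η μ ⊨ P

  open _∣_⊨_

  module _ {η : ℕ → ℕ} where

    notʳ : ∀ {a P} → η ∣ a ⊨ P → η ∣ notᵗ a ⊨ ¬ P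
    notʳ {a} (reflects r) = reflects (¬-⊨ {eval a η μ} r)

    andʳ : ∀ {a b P Q} → η ∣ a ⊨ P → η ∣ b ⊨ Q → η ∣ a andᵗ b ⊨ P × Q
    andʳ {a} (reflects r) (reflects s) = reflects (×-⊨ {eval a η μ} r s)

    orʳ : ∀ {a b P Q} → η ∣ a ⊨ P → η ∣ b ⊨ Q → η ∣ a orᵗ b ⊨ P ⊎ Q
    orʳ {a} (reflects r) (reflects s) = reflects (⊎-⊨ {eval a η μ} r s)

    impʳ : ∀ {a b P Q} → η ∣ a ⊨ P → η ∣ b ⊨ Q → η ∣ a impᵗ b ⊨ (P → Q)
    impʳ {a} (reflects r) (reflects s) = reflects (→-⊨ {eval a η μ} r s)

    eqʳ : ∀ {x y} {u v : Fin n} → η x ≡ toℕ u → η y ≡ toℕ v → η ∣ var x eqᵗ var y ⊨ u ≡ v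
    eqʳ {x} {y} x≡u y≡v = reflects (⊨-⇔
      (mk⇔ (λ e → toℕ-injective (trans (sym x≡u) (trans e y≡v)))
           (λ { refl → trans x≡u (sym y≡v) }))
      (≡-⊨ (η x) (η y)))

    ⇔ʳ : ∀ {a P Q} → P ⇔ Q → η ∣ a ⊨ P → η ∣ a ⊨ Q
    ⇔ʳ P⇔Q (reflects r) = reflects (⊨-⇔ P⇔Q r)

  order-correct : ∀ η → η 0 ≡ len → eval order-of η μ ≡ n
  order-correct η η0≡len rewrite η0≡len = ∑-initial len n≤len ones zeros
    where
    ones : ∀ {i} → i < n → 1 ∸ ∑ (1 + i) (λ j → 1 ∸ μ j) ≡ 1
    ones {i} i<n = cong (1 ∸_) (trans
      (∑-cong (1 + i) (λ j≤i → cong (1 ∸_) (μ-unary (≤-trans j≤i i<n))))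
      (trans (∑-const (1 + i) 0) (*-zeroʳ i)))
    zeros : ∀ {i} → n ≤ i → 1 ∸ ∑ (1 + i) (λ j → 1 ∸ μ j) ≡ 0
    -- From position `n` on, the inspected prefix contains the separator, a 0 at position `n`.
    zeros {i} n≤i = m≤n⇒m∸n≡0 (n≢0⇒n>0 (from (∑-⊨ (1 + i) {λ j → 1 ∸ μ j}) (n , s≤s n≤i , μ-n)))
      where
      μ-n : 1 ∸ μ n ≢ 0
      μ-n rewrite trans (cong μ (sym (+-identityʳ n))) (μ-after 0) = λ ()

  ∃ʳ : ∀ {η x b} {P : Fin n → Set} → η 0 ≡ len →
    (∀ i → η [ x ↦ toℕ i ] ∣ b ⊨ P i) → η ∣ ∑[ x < order-of ] b ⊨ ∃ P
  ∃ʳ {η} {x} {b} η0 r = reflects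
    (∃-⊨ {f = λ i → eval b (η [ x ↦ i ]) μ} (order-correct η η0) (λ i → reflected (r i)))

  ∀ʳ : ∀ {η x b} {P : Fin n → Set} → η 0 ≡ len →
    (∀ i → η [ x ↦ toℕ i ] ∣ b ⊨ P i) → η ∣ allᵗ x order-of b ⊨ (∀ i → P i)
  ∀ʳ {η} {x} {b} η0 r = reflects
    (∀-⊨ {f = λ i → eval b (η [ x ↦ i ]) μ} (order-correct η η0) (λ i → reflected (r i)))

  multiple-correct : ∀ η a → η 0 ≡ len → eval (∑[ 1 < a ] order-of) η μ ≡ eval a η μ * n
  multiple-correct η a η0 =
    trans (∑-cong (eval a η μ) (λ {i} _ → order-correct (η [ 1 ↦ i ]) η0)) (∑-const (eval a η μ) n)

  adjacentʳ : ∀ {η x y} {u v : Fin n} → η 0 ≡ len → η x ≡ toℕ u → η y ≡ toℕ v →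
    η ∣ adjacentᵗ x y ⊨ adj G u v ≡ true
  adjacentʳ {η} {x} {y} {u} {v} η0 x≡u y≡v =
    reflects (subst (_⊨ adj G u v ≡ true) (sym value) bit-⊨)
    where
    value : eval (adjacentᵗ x y) η μ ≡ toℕ (entry u v)
    value = begin
      eval (adjacentᵗ x y) η μ
        ≡⟨ cong₂ (λ a b → μ (a + (1 + b))) (order-correct η η0)
            (cong₂ _+_ (trans (multiple-correct η (var x) η0) (cong (_* n) x≡u)) y≡v) ⟩
      μ (n + (1 + (toℕ u * n + toℕ v)))
        ≡⟨ μ-after _ ⟩
      cells (matrix entry ++ ds) (toℕ u * n + toℕ v)
        ≡⟨ cells-matrix entry ds u v ⟩
      toℕ (entry u v) ∎
      where open ≡-Reasoning
    bit-⊨ : toℕ (entry u v) ⊨ adj G u v ≡ true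
    bit-⊨ with adj G u v
    ... | true  = mk⇔ (λ _ → refl) (λ _ ())
    ... | false = mk⇔ (λ e → contradiction refl e) (λ ())

  digit-correct : ∀ η a → η 0 ≡ len → eval (digitᵗ a) η μ ≡ cells ds (eval a η μ)
  digit-correct η a η0 = begin
    eval (digitᵗ a) η μ
      ≡⟨ cong₂ (λ b c → μ (b + (1 + (c + eval a η μ)))) (order-correct η η0)
          (trans (multiple-correct η order-of η0) (cong (_* n) (order-correct η η0))) ⟩
    μ (n + (1 + (n * n + eval a η μ)))
      ≡⟨ μ-after _ ⟩
    cells (matrix entry ++ ds) (n * n + eval a η μ)
      ≡⟨ cells-after-matrix entry ds _ ⟩
    cells ds (eval a η μ) ∎
    where open ≡-Reasoning

  positiveʳ : ∀ {η} m → η 0 ≡ len → η ∣ positiveᵗ m ⊨ 1 ≤ fromDigits (drop m ds)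
  positiveʳ {η} m η0 = reflects (subst (_⊨ 1 ≤ fromDigits (drop m ds)) (sym value)
    (positive-digits (drop m ds) (≤-trans (length-drop≤ m ds) ds≤len)))
    where
    value : eval (positiveᵗ m) η μ ≡ ∑ len (cells (drop m ds))
    value = trans (cong (λ l → ∑ l (λ i → eval (digitᵗ (con m ⊞ var 1)) (η [ 1 ↦ i ]) μ)) η0)
      (∑-cong len (λ {i} _ →
        trans (digit-correct (η [ 1 ↦ i ]) (con m ⊞ var 1) η0) (cells-drop m ds i)))
    length-drop≤ : ∀ m (ds : List Bit) → length (drop m ds) ≤ length ds
    length-drop≤ m ds = ≤-trans (≤-reflexive (length-drop m ds)) (m∸n≤m (length ds) m)

  uniqueʳ : ∀ {η} P {Q : Fin n → Set} → η 0 ≡ len →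
    (∀ w → η [ 5 ↦ toℕ w ] ∣ P 5 ⊨ Q w) →
    (∀ w w′ → (η [ 5 ↦ toℕ w ]) [ 6 ↦ toℕ w′ ] ∣ P 6 ⊨ Q w′) →
    η ∣ uniqueᵗ P ⊨ Unique Q
  uniqueʳ P {Q} η0 r₅ r₆ = ⇔ʳ {P = ∃[ w ] Q w × (∀ w′ → Q w′ → w′ ≡ w)}
    (mk⇔ (λ (w , q , only) → w , q , λ {w′} → only w′) (λ (w , q , only) → w , q , λ w′ → only))
    (∃ʳ η0 λ w → andʳ (r₅ w)
      (∀ʳ {P = λ w′ → Q w′ → w′ ≡ w} η0 λ w′ → impʳ (r₆ w w′) (eqʳ refl refl)))

  module _ (nbᵗ : ℕ → ℕ → Term) (nb : Fin n → Fin n → Set)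
    (nbʳ : ∀ {η x y} {u v : Fin n} → η 0 ≡ len → η x ≡ toℕ u → η y ≡ toℕ v → η ∣ nbᵗ x y ⊨ nb u v)
    where

    open Algorithm nbᵗ

    -- `P` is evaluated under the binders 4, 5 and 6, so its correctness is required in every
    -- environment that agrees with `η` on the parameters 2 and 3 and still has the length in
    -- variable 0.
    goodʳ : ∀ {η P} {Q : Fin n → Set} → η 0 ≡ len →
      (∀ {η′ y v} → η′ 0 ≡ len → η′ 2 ≡ η 2 → η′ 3 ≡ η 3 → η′ y ≡ toℕ v → η′ ∣ P y ⊨ Q v) →
      η ∣ goodᵗ P ⊨ Good nb Q
    goodʳ {P = P} η0 r = ∀ʳ η0 λ x → orʳ
      (uniqueʳ (λ w → nbᵗ 4 w andᵗ P w) η0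
        (λ w → andʳ (nbʳ η0 refl refl) (r η0 refl refl refl))
        (λ w w′ → andʳ (nbʳ η0 refl refl) (r η0 refl refl refl)))
      (uniqueʳ (λ w → nbᵗ 4 w andᵗ notᵗ (P w)) η0
        (λ w → andʳ (nbʳ η0 refl refl) (notʳ (r η0 refl refl refl)))
        (λ w w′ → andʳ (nbʳ η0 refl refl) (notʳ (r η0 refl refl refl))))

    two-colourableʳ : ∀ {η} → η 0 ≡ len →
      η ∣ ∑[ 2 < order-of ] ∑[ 3 < order-of ] (goodᵗ pairᵗ orᵗ goodᵗ puncturedᵗ)
        ⊨ TwoColourable G nb
    two-colourableʳ η0 = ∃ʳ η0 λ u → ∃ʳ η0 λ v → orʳ
      (goodʳ η0 λ _ e₂ e₃ e → orʳ (eqʳ e e₂) (eqʳ e e₃))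
      (goodʳ η0 λ e₀ e₂ e₃ e → andʳ (adjacentʳ e₀ e₂ e) (notʳ (eqʳ e e₃)))

    two-verticesʳ : ∀ {η} → η 0 ≡ len → η ∣ order-of ⊟ con 1 ⊨ 2 ≤ n
    two-verticesʳ {η} η0 =
      reflects (subst (λ m → m ∸ 1 ⊨ 2 ≤ n) (sym (order-correct η η0)) (positive n))
      where
      positive : ∀ n → n ∸ 1 ⊨ 2 ≤ n
      positive zero          = mk⇔ (λ e → contradiction refl e) (λ ())
      positive (suc zero)    = mk⇔ (λ e → contradiction refl e) λ { (s≤s ()) }
      positive (suc (suc n)) = mk⇔ (λ _ → s≤s (s≤s z≤n)) (λ _ ())

    criterionʳ : ∀ {η} → η 0 ≡ len → η ∣ criterionᵗ ⊨ Criterion G nb (fromDigits ds)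
    criterionʳ {η} η0 = orʳ
      (andʳ (⇔ʳ (three≤ ds) (orʳ (positiveʳ 2 η0) (andʳ (positiveʳ 1 η0) lowest)))
            (two-verticesʳ η0))
      (orʳ (andʳ (⇔ʳ (two≤ ds) (positiveʳ 1 η0)) (two-colourableʳ η0))
           (andʳ (positiveʳ 0 η0)
             (∀ʳ η0 λ x → uniqueʳ (nbᵗ 4) η0 (λ w → nbʳ η0 refl refl) (λ w w′ → nbʳ η0 refl refl))))
      where
      lowest : η ∣ digitᵗ (con 0) ⊨ cells ds 0 ≢ 0
      lowest = reflects (subst (_⊨ cells ds 0 ≢ 0) (sym (digit-correct η (con 0) η0)) (mk⇔ id id))

-- The open and the closed neighbourhood problem

openᵗ closedᵗ : ℕ → ℕ → Term
openᵗ       = adjacentᵗ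
closedᵗ x y = adjacentᵗ x y orᵗ var y eqᵗ var x

decidable : (nbᵗ : ℕ → ℕ → Term)
  (nb : ∀ {n} → Graph n → Fin n → Fin n → Set) {Yes : Instance → Set} →
  (∀ {n} (G : Graph n) ds → let open Reflection G ds in ∀ {η x y} {u v : Fin n} →
     η 0 ≡ len → η x ≡ toℕ u → η y ≡ toℕ v → η ∣ nbᵗ x y ⊨ nb G u v) →
  (∀ {n} (G : Graph n) {x w} → adj G x w ≡ true → nb G x w) →
  (∀ {n} (G : Graph n) → (∀ x → nb G x x) ⊎ (∀ {x w} → nb G x w → adj G x w ≡ true)) →
  (∀ I → Yes I ⇔ Colourable (nb (graph I)) (colours I)) →
  PolyTimeDecidable encode ConnectedCograph Yes
decidable nbᵗ nb nbʳ adj⇒nb self yes⇔ =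
  decided-by encode (Algorithm.criterionᵗ nbᵗ) nonempty correct
  where
  nonempty : ∀ I → ConnectedCograph I → 0 < length (encode I)
  nonempty I ((nonzero , _) , _) = <-≤-trans (>-nonZero⁻¹ _ {{nonzero}})
    (Reflection.n≤len (graph I) (proj₁ (toDigits 2 (colours I))))
  correct : ∀ I → ConnectedCograph I → _
  correct I (connected , P₄-free) = ⊨-⇔
    (mk⇔ (λ c → from (yes⇔ I) (from crit (subst (Criterion G (nb G)) digits c)))
         (λ y → subst (Criterion G (nb G)) (sym digits) (to crit (to (yes⇔ I) y))))
    (reflected (criterionʳ nbᵗ (nb G) (nbʳ G ds) {free (encode I)} refl))
    where
    G = graph I
    ds = proj₁ (toDigits 2 (colours I))
    digits = proj₂ (toDigits 2 (colours I))
    crit = criterion G (nb G) (adj⇒nb G) (self G) connected P₄-free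
    open Reflection G ds
    open _∣_⊨_

theorem7 : PolyTimeDecidable encode ConnectedCograph CFCNColourable
    × PolyTimeDecidable encode ConnectedCograph CFONColourable
theorem7 =
  decidable closedᵗ Closed
    (λ G ds η0 x≡u y≡v → let open Reflection G ds in orʳ (adjacentʳ η0 x≡u y≡v) (eqʳ y≡v x≡u))
    (λ G → inj₁) (λ G → inj₁ λ x → inj₂ refl)
    (λ I → colourable (∈-closed {G = graph I})) ,
  decidable openᵗ Open
    (λ G ds → Reflection.adjacentʳ G ds)
    (λ G → id) (λ G → inj₂ id)
    (λ I → colourable (∈-tabulate {f = adj (graph I) _}))
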